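{- Let $p_7(n)$ denote the number of partitions of $n$ into parts congruent to $\pm 2, \pm 6, \pm 7, \pm 8,\pm 9,\pm 10,\pm 12,\pm 13,\pm 17,\pm 21,\pm 22,\pm 23,\pm 24,\pm 28 \pmod{60}$, where the parts congruent to $\pm 10 \pmod{60}$ have two colors. Let $p_8(n)$ denote the number of partitions of $n$ into parts congruent to $\pm 1, \pm 3, \pm 4, \pm 10,\pm 11,\pm 12,\pm 14,\pm 16,\pm 18, \pm 19,\pm 24,\pm 26,\pm 27,\pm 29 \pmod{60}$, where the parts congruent to $\pm 10 \pmod{60}$ have two colors. Let $p_9(n)$ denote the number of partitions of $n$ into parts congruent to $\pm 1, \pm 4, \pm 5, \pm 6,\pm 11,\pm 12,\pm 14,\pm 16, \pm 18, \pm 19,\pm 25,\pm 26, \pm 29 \pmod{60}$, where the parts congruent to $\pm 12, \pm 18 \pmod{60}$ have two colors. Let $p_{10}(n)$ denote the number of partitions of $n$ into parts congruent to $\pm 2, \pm 5, \pm 6,\pm 7,\pm 8,\pm 13,\pm 17,\pm 18,\pm 22, \pm 23,\pm 24,\pm 25,\pm 28 \pmod{60}$, where the parts congruent to $\pm 6, \pm 24 \pmod{60}$ have two colors. Then for each positive integer $n>1$, \[ p_7(n)+p_8(n-1)=p_9(n)+p_{10}(n-2). \]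
   Context: A partition in which parts from certain residue classes "have two colors" means each such part size may appear in two distinguishable copies (colors), so the generating function for parts $\equiv r \pmod{s}$ with $k$ colors is $\prod_{m\ge0}(1-q^{sm+r})^{ -k}$. Here $\pm r \pmod{60}$ means the classes $r$ and $60-r$ modulo $60$; parts are positive integers. By convention $p_i(0)=1$. -}

module Defs where

open import Data.Nat using (ℕ; zero; suc; _+_; _*_; _∸_; _≤ᵇ_; _≡ᵇ_; _%_)
open import Data.Bool using (Bool; true; false; if_then_else_; _∨_)
open import Data.List using (List; []; _∷_; concatMap; map; upTo; replicate)
open import Data.Nat.ListAction using (sum)
open import Data.Bool.ListAction using (any)

memᵇ : ℕ → List ℕ → Bool
memᵇ x xs = any (λ y → x ≡ᵇ y) xs

pm60 : List ℕ → List ℕ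
pm60 = concatMap (λ r → r ∷ (60 ∸ r) ∷ [])

colors : (allowed doubled : List ℕ) → ℕ → ℕ
colors allowed doubled s =
  if memᵇ (s % 60) (pm60 allowed)
  then (if memᵇ (s % 60) (pm60 doubled) then 2 else 1)
  else 0

-- Number of partitions of n using the given list of part "kinds"; each kind
-- is a (positive) part size, and distinct list entries are distinguishable
-- (a size repeated k times = that size in k colors).  We choose a
-- multiplicity j ∈ {0,…,n} for the first kind and recurse.
countKinds : List ℕ → ℕ → ℕ
countKinds [] zero = 1
countKinds [] (suc n) = 0
countKinds (s ∷ ks) n =
  sum (map (λ j → if j * s ≤ᵇ n then countKinds ks (n ∸ j * s) else 0) (upTo (suc n)))

kinds : (ℕ → ℕ) → ℕ → List ℕ
kinds col n = concatMap (λ i → replicate (col (suc i)) (suc i)) (upTo n)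

-- Number of partitions of n into positive parts, where a part of size s
-- comes in col s colors (col s = 0 means size s is not allowed).
-- Convention: value 1 at n = 0.
colPart : (ℕ → ℕ) → ℕ → ℕ
colPart col n = countKinds (kinds col n) n

p₇ p₈ p₉ p₁₀ : ℕ → ℕ
p₇ = colPart (colors (2 ∷ 6 ∷ 7 ∷ 8 ∷ 9 ∷ 10 ∷ 12 ∷ 13 ∷ 17 ∷ 21 ∷ 22 ∷ 23 ∷ 24 ∷ 28 ∷ []) (10 ∷ []))
p₈ = colPart (colors (1 ∷ 3 ∷ 4 ∷ 10 ∷ 11 ∷ 12 ∷ 14 ∷ 16 ∷ 18 ∷ 19 ∷ 24 ∷ 26 ∷ 27 ∷ 29 ∷ []) (10 ∷ []))
p₉ = colPart (colors (1 ∷ 4 ∷ 5 ∷ 6 ∷ 11 ∷ 12 ∷ 14 ∷ 16 ∷ 18 ∷ 19 ∷ 25 ∷ 26 ∷ 29 ∷ []) (12 ∷ 18 ∷ []))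
p₁₀ = colPart (colors (2 ∷ 5 ∷ 6 ∷ 7 ∷ 8 ∷ 13 ∷ 17 ∷ 18 ∷ 22 ∷ 23 ∷ 24 ∷ 25 ∷ 28 ∷ []) (6 ∷ 24 ∷ []))

{-# OPTIONS --safe #-}
module Submission where

-- Write [r] for (q^r; q^60)_∞ (q^(60-r); q^60)_∞ and P₇, …, P₁₀ for the generating
-- functions.  Both P₇ - q² P₁₀ and P₉ - q P₈ equal
--   (q^15; q^30)_∞² / ([6] [10] [12] [18] [24]).
-- After clearing denominators these two equalities become, by the Jacobi triple
-- product,
--   f(-q²,-q¹³) f(-q⁷,-q⁸)  = f(q⁹,q²¹) f(q¹⁰,q²⁰) - q² f(q²⁴,q⁶) f(q²⁵,q⁵)
--   f(-q,-q¹⁴)  f(-q⁴,-q¹¹) = f(q⁵,q²⁵) f(q¹²,q¹⁸) - q  f(q²⁰,q¹⁰) f(q²⁷,q³)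
-- for Ramanujan's theta function f(a,b) = Σ a^(n(n+1)/2) b^(n(n-1)/2), n ∈ ℤ, and both
-- are instances of the parity dissection of the double series of
--   f(a,auv) f(av,au) = f(a²v,a²u²v) f(a²u,a²uv²) + a f(a⁴uv²,u) f(a⁴u²v,v).
-- A coefficient of bounded degree sees only the quotient ℤ[[q]] / (q^L), where q is
-- nilpotent and every infinite product and series is finite; the q-series identities
-- are proved for nilpotent elements of an arbitrary commutative ring.

-- The two dissections are the cases (a, u, v) = (-q², q⁶, q⁵) and (-q, q¹⁰, q³). Both satisfy a²uv
-- = q¹⁵, so the theta functions on the left have base q¹⁵, while those on the right, whose
-- arguments multiply to a⁴u²v², have base q³⁰. Turning their factors 1 + y into 1 - y² doubles this
-- to 60, the modulus of the theorem. The sign of a survives only in odd powers, which is why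
-- negative arguments occur on the left alone. One number L is at once the exponent of nilpotency,
-- the number of factors of every product and the cut-off of every theta series. This loses nothing,
-- because the n-th theta term contains one of its two arguments to a power of at least |n|. Neither
-- subtraction of series nor division is used in the final comparison: the odd part of each
-- dissection is moved to the side of the negative theta functions, denominators are cleared, and a
-- unit is cancelled from an equation between sums.

open import Defs
open import Algebra.Bundles using (CommutativeRing)
open import Data.Bool.Base using (T; true; false; if_then_else_)
open import Data.Nat.Base as ℕ using (ℕ; zero; suc)
import Data.Nat.DivMod as ℕ-DivMod
open import Data.Nat.ListAction using (sum)
import Data.Nat.Properties as ℕₚ
import Data.Nat.Tactic.RingSolver as ℕ-RingSolver
open import Data.Integer.Base as ℤ using (ℤ; +_; -[1+_]; ∣_∣)
import Data.Integer.Properties as ℤₚ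
open import Data.Integer.Tactic.RingSolver using (solve-∀)
open import Data.List.Base using (List; []; _∷_; _++_; map; concatMap; replicate; upTo; applyUpTo)
import Data.List.Properties as Listₚ
open import Data.List.Relation.Binary.Permutation.Propositional as Perm using (_↭_; ↭-sym; ↭-trans; ↭-reflexive)
open import Data.List.Relation.Unary.All as All using (All; []; _∷_)
import Data.List.Relation.Unary.All.Properties as Allₚ
open import Data.List.Sort.Base ℕₚ.≤-totalOrder using (module SortingAlgorithm)
open import Data.List.Sort.InsertionSort ℕₚ.≤-decTotalOrder using (insertionSort)
open import Data.Product.Base using (∃; _,_)
open import Function.Base using (_∘_)
open import Function.Bundles using (mk⇔)
open import Relation.Nullary using (yes; no; contradiction)
open import Relation.Nullary.Decidable using (does-⇔)
open import Relation.Binary.PropositionalEquality as ≡ using (_≡_)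

open SortingAlgorithm insertionSort using (sort; sort-↭)

-- Exponents of theta series

choose₂ : ℕ → ℕ
choose₂ zero    = 0
choose₂ (suc n) = n ℕ.+ choose₂ n

-- n (n + 1) / 2 and n (n - 1) / 2: the exponents of a and b in the n-th term
-- of Ramanujan's theta series f(a, b).
expᵃ expᵇ : ℤ → ℕ
expᵃ (+ n)    = choose₂ (suc n)
expᵃ -[1+ n ] = choose₂ (suc n)
expᵇ (+ n)    = choose₂ n
expᵇ -[1+ n ] = choose₂ (suc (suc n))

double-choose₂ : ∀ n → + 2 ℤ.* + choose₂ (suc n) ≡ + n ℤ.* (+ n ℤ.+ + 1)
double-choose₂ zero    = ≡.refl
double-choose₂ (suc n) = begin
  + 2 ℤ.* (+ 1 ℤ.+ + n ℤ.+ + choose₂ (suc n))                ≡⟨ ℤₚ.*-distribˡ-+ (+ 2) (+ suc n) (+ choose₂ (suc n)) ⟩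
  + 2 ℤ.* (+ 1 ℤ.+ + n) ℤ.+ + 2 ℤ.* + choose₂ (suc n)        ≡⟨ ≡.cong (λ z → + 2 ℤ.* + suc n ℤ.+ z) (double-choose₂ n) ⟩
  + 2 ℤ.* (+ 1 ℤ.+ + n) ℤ.+ + n ℤ.* (+ n ℤ.+ + 1)            ≡⟨ expand (+ n) ⟩
  (+ 1 ℤ.+ + n) ℤ.* ((+ 1 ℤ.+ + n) ℤ.+ + 1)                  ∎
  where
  open ≡.≡-Reasoning
  expand : ∀ n → + 2 ℤ.* (+ 1 ℤ.+ n) ℤ.+ n ℤ.* (n ℤ.+ + 1) ≡ (+ 1 ℤ.+ n) ℤ.* ((+ 1 ℤ.+ n) ℤ.+ + 1)
  expand = solve-∀

double-expᵃ : ∀ n → + 2 ℤ.* + expᵃ n ≡ n ℤ.* (n ℤ.+ + 1)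
double-expᵃ (+ n)    = double-choose₂ n
double-expᵃ -[1+ n ] = ≡.trans (double-choose₂ n) (reflect (+ n))
  where
  reflect : ∀ n → n ℤ.* (n ℤ.+ + 1) ≡ ℤ.- (+ 1 ℤ.+ n) ℤ.* (ℤ.- (+ 1 ℤ.+ n) ℤ.+ + 1)
  reflect = solve-∀

double-expᵇ : ∀ n → + 2 ℤ.* + expᵇ n ≡ n ℤ.* (n ℤ.- + 1)
double-expᵇ (+ zero)  = ≡.refl
double-expᵇ (+ suc n) = ≡.trans (double-choose₂ n) (reflect (+ n))
  where
  reflect : ∀ n → n ℤ.* (n ℤ.+ + 1) ≡ (+ 1 ℤ.+ n) ℤ.* ((+ 1 ℤ.+ n) ℤ.- + 1)
  reflect = solve-∀
double-expᵇ -[1+ n ]  = ≡.trans (double-choose₂ (suc n)) (reflect (+ n))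
  where
  reflect : ∀ n → (+ 1 ℤ.+ n) ℤ.* ((+ 1 ℤ.+ n) ℤ.+ + 1) ≡ ℤ.- (+ 1 ℤ.+ n) ℤ.* (ℤ.- (+ 1 ℤ.+ n) ℤ.- + 1)
  reflect = solve-∀

n≤choose₂[1+n] : ∀ n → n ℕ.≤ choose₂ (suc n)
n≤choose₂[1+n] n = ℕₚ.m≤m+n n (choose₂ n)

-- Formal linear combinations of expᵃ and expᵇ values, to be compared by
-- doubling them and applying the integer ring solver.
data Exponent : Set where
  const      : ℕ → Exponent
  triᵃ triᵇ  : ℤ → Exponent
  _⊕_        : Exponent → Exponent → Exponent
  _⊛_        : ℕ → Exponent → Exponent

infixl 6 _⊕_
infixr 7 _⊛_

⟦_⟧ : Exponent → ℕ
⟦ const n ⟧ = n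
⟦ triᵃ n ⟧  = expᵃ n
⟦ triᵇ n ⟧  = expᵇ n
⟦ x ⊕ y ⟧   = ⟦ x ⟧ ℕ.+ ⟦ y ⟧
⟦ n ⊛ x ⟧   = n ℕ.* ⟦ x ⟧

double : Exponent → ℤ
double (const n) = + 2 ℤ.* + n
double (triᵃ n)  = n ℤ.* (n ℤ.+ + 1)
double (triᵇ n)  = n ℤ.* (n ℤ.- + 1)
double (x ⊕ y)   = double x ℤ.+ double y
double (n ⊛ x)   = + n ℤ.* double x

double-sound : ∀ x → + 2 ℤ.* + ⟦ x ⟧ ≡ double x
double-sound (const n) = ≡.refl
double-sound (triᵃ n)  = double-expᵃ n
double-sound (triᵇ n)  = double-expᵇ n
double-sound (x ⊕ y)   = ≡.trans (ℤₚ.*-distribˡ-+ (+ 2) (+ ⟦ x ⟧) (+ ⟦ y ⟧))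
                                 (≡.cong₂ ℤ._+_ (double-sound x) (double-sound y))
double-sound (n ⊛ x)   = begin
  + 2 ℤ.* + (n ℕ.* ⟦ x ⟧)    ≡⟨ ≡.cong (+ 2 ℤ.*_) (ℤₚ.pos-* n ⟦ x ⟧) ⟩
  + 2 ℤ.* (+ n ℤ.* + ⟦ x ⟧)  ≡⟨ swap (+ n) (+ ⟦ x ⟧) ⟩
  + n ℤ.* (+ 2 ℤ.* + ⟦ x ⟧)  ≡⟨ ≡.cong (+ n ℤ.*_) (double-sound x) ⟩
  + n ℤ.* double x           ∎
  where
  open ≡.≡-Reasoning
  swap : ∀ n x → + 2 ℤ.* (n ℤ.* x) ≡ n ℤ.* (+ 2 ℤ.* x)
  swap = solve-∀

exponent-≡ : ∀ x y → double x ≡ double y → ⟦ x ⟧ ≡ ⟦ y ⟧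
exponent-≡ x y eq = ℤₚ.+-injective (ℤₚ.*-cancelˡ-≡ (+ 2) (+ ⟦ x ⟧) (+ ⟦ y ⟧)
  (≡.trans (double-sound x) (≡.trans eq (≡.sym (double-sound y)))))

-- Lists of part sizes

-- Cutting the sizes at `m` serves two ends: with `m` a multiple of the period it peels off one
-- block of residues, and with `m` equal to the partitioned number it separates the parts that are
-- too large to occur.
kinds-+ : ∀ col m n → kinds col (m ℕ.+ n) ≡ kinds col m ++ map (m ℕ.+_) (kinds (λ s → col (m ℕ.+ s)) n)
kinds-+ col m n = begin
  concatMap kind (upTo (m ℕ.+ n))
    ≡⟨ ≡.cong (concatMap kind) (applyUpTo-+ (λ i → i) m n) ⟩
  concatMap kind (upTo m ++ applyUpTo (m ℕ.+_) n)
    ≡⟨ Listₚ.concatMap-++ kind (upTo m) _ ⟩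
  kinds col m ++ concatMap kind (applyUpTo (m ℕ.+_) n)
    ≡⟨ ≡.cong (λ is → kinds col m ++ concatMap kind is) (Listₚ.map-upTo (m ℕ.+_) n) ⟨
  kinds col m ++ concatMap kind (map (m ℕ.+_) (upTo n))
    ≡⟨ ≡.cong (kinds col m ++_) (Listₚ.concatMap-map kind (m ℕ.+_) (upTo n)) ⟩
  kinds col m ++ concatMap (λ i → kind (m ℕ.+ i)) (upTo n)
    ≡⟨ ≡.cong (kinds col m ++_) (Listₚ.concatMap-cong shifted (upTo n)) ⟩
  kinds col m ++ concatMap (λ i → map (m ℕ.+_) (replicate (col (m ℕ.+ suc i)) (suc i))) (upTo n)
    ≡⟨ ≡.cong (kinds col m ++_) (Listₚ.map-concatMap (m ℕ.+_) _ (upTo n)) ⟨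
  kinds col m ++ map (m ℕ.+_) (kinds (λ s → col (m ℕ.+ s)) n)  ∎
  where
  open ≡.≡-Reasoning
  kind : ℕ → List ℕ
  kind i = replicate (col (suc i)) (suc i)
  applyUpTo-+ : ∀ (f : ℕ → ℕ) m n → applyUpTo f (m ℕ.+ n) ≡ applyUpTo f m ++ applyUpTo (λ i → f (m ℕ.+ i)) n
  applyUpTo-+ f zero    n = ≡.refl
  applyUpTo-+ f (suc m) n = ≡.cong (f 0 ∷_) (applyUpTo-+ (f ∘ suc) m n)
  shifted : ∀ i → kind (m ℕ.+ i) ≡ map (m ℕ.+_) (replicate (col (m ℕ.+ suc i)) (suc i))
  shifted i = ≡.trans
    (≡.cong (λ s → replicate (col s) s) (≡.sym (ℕₚ.+-suc m i)))
    (≡.sym (Listₚ.map-replicate (m ℕ.+_) (col (m ℕ.+ suc i)) (suc i)))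

kinds-cong : ∀ {col col′} → (∀ s → col s ≡ col′ s) → ∀ n → kinds col n ≡ kinds col′ n
kinds-cong eq n = Listₚ.concatMap-cong (λ i → ≡.cong (λ c → replicate c (suc i)) (eq (suc i))) (upTo n)

kinds-positive : ∀ col n → All (0 ℕ.<_) (kinds col n)
kinds-positive col n = Allₚ.concat⁺ (Allₚ.map⁺
  (All.universal (λ i → Allₚ.replicate⁺ (col (suc i)) (ℕ.s≤s ℕ.z≤n)) (upTo n)))

-- Sorted lists are normal forms, so a permutation between closed lists is established by
-- evaluation, with `≡.refl` as the proof.
sort-≡⇒↭ : ∀ {xs ys} → sort xs ≡ sort ys → xs ↭ ys
sort-≡⇒↭ {xs} {ys} eq = ↭-trans (↭-sym (sort-↭ xs)) (↭-trans (↭-reflexive eq) (sort-↭ ys))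

allowed₇ allowed₈ allowed₉ allowed₁₀ : List ℕ
allowed₇  = 2 ∷ 6 ∷ 7 ∷ 8 ∷ 9 ∷ 10 ∷ 12 ∷ 13 ∷ 17 ∷ 21 ∷ 22 ∷ 23 ∷ 24 ∷ 28 ∷ []
allowed₈  = 1 ∷ 3 ∷ 4 ∷ 10 ∷ 11 ∷ 12 ∷ 14 ∷ 16 ∷ 18 ∷ 19 ∷ 24 ∷ 26 ∷ 27 ∷ 29 ∷ []
allowed₉  = 1 ∷ 4 ∷ 5 ∷ 6 ∷ 11 ∷ 12 ∷ 14 ∷ 16 ∷ 18 ∷ 19 ∷ 25 ∷ 26 ∷ 29 ∷ []
allowed₁₀ = 2 ∷ 5 ∷ 6 ∷ 7 ∷ 8 ∷ 13 ∷ 17 ∷ 18 ∷ 22 ∷ 23 ∷ 24 ∷ 25 ∷ 28 ∷ []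

-- `p₇` unfolds to `colPart col₇`, and likewise for the others, so lemmas about an arbitrary
-- colouring apply to them.
col₇ col₈ col₉ col₁₀ : ℕ → ℕ
col₇  = colors allowed₇ (10 ∷ [])
col₈  = colors allowed₈ (10 ∷ [])
col₉  = colors allowed₉ (12 ∷ 18 ∷ [])
col₁₀ = colors allowed₁₀ (6 ∷ 24 ∷ [])

-- (q^r; q^15)_∞ as four products to base q^60, in the order in which two successive parity
-- splittings produce them.
split₁₅ : ℕ → List ℕ
split₁₅ r = r ∷ 30 ℕ.+ r ∷ 15 ℕ.+ r ∷ 45 ℕ.+ r ∷ []

-- The factors modulo 60 of f(-q^i, -q^j) for i + j = 15, and, for i + j = 30,
-- those of the numerator and denominator of f(q^i, q^j), using
-- 1 + y = (1 - y²) / (1 - y).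
negTheta posThetaNum posThetaDen : ℕ → ℕ → List ℕ
negTheta i j    = split₁₅ i ++ split₁₅ j ++ split₁₅ 15
posThetaNum i j = i ℕ.+ i ∷ j ℕ.+ j ∷ 30 ∷ 60 ∷ []
posThetaDen i j = i ∷ 30 ℕ.+ i ∷ j ∷ 30 ℕ.+ j ∷ []

-- common and common′ make the left-hand sides of the two dissections agree (negNum↭negNum′),
-- and clearing is a common denominator of all four generating functions.
evenDen oddDen negNum evenNum oddNum evenDen′ oddDen′ negNum′ evenNum′ oddNum′ common common′ clearing : List ℕ
evenDen   = posThetaDen 9 21 ++ posThetaDen 10 20
oddDen    = posThetaDen 24 6 ++ posThetaDen 25 5
negNum       = (negTheta 2 13 ++ negTheta 7 8) ++ (evenDen ++ oddDen)
evenNum   = (posThetaNum 9 21 ++ posThetaNum 10 20) ++ oddDen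
oddNum    = (posThetaNum 24 6 ++ posThetaNum 25 5) ++ evenDen
evenDen′  = posThetaDen 5 25 ++ posThetaDen 12 18
oddDen′   = posThetaDen 20 10 ++ posThetaDen 27 3
negNum′      = (negTheta 1 14 ++ negTheta 4 11) ++ (evenDen′ ++ oddDen′)
evenNum′  = (posThetaNum 5 25 ++ posThetaNum 12 18) ++ oddDen′
oddNum′   = (posThetaNum 20 10 ++ posThetaNum 27 3) ++ evenDen′
common    = 1 ∷ 3 ∷ 4 ∷ 11 ∷ 12 ∷ 14 ∷ 16 ∷ 18 ∷ 19 ∷ 26 ∷ 27 ∷ 29 ∷ 31 ∷ 33 ∷ 34 ∷ 41 ∷ 42 ∷ 44 ∷ 46 ∷ 48 ∷ 49 ∷ 56 ∷ 57 ∷ 59 ∷ []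
common′   = 2 ∷ 6 ∷ 7 ∷ 8 ∷ 9 ∷ 13 ∷ 17 ∷ 21 ∷ 22 ∷ 23 ∷ 24 ∷ 28 ∷ 32 ∷ 36 ∷ 37 ∷ 38 ∷ 39 ∷ 43 ∷ 47 ∷ 51 ∷ 52 ∷ 53 ∷ 54 ∷ 58 ∷ []
clearing  = kinds col₇ 60 ++ (evenNum ++ common)

-- Multiplication by `clearing` turns P₇, P₈, P₉, P₁₀ into the products over `evenNum ++ common`,
-- `oddNum′ ++ common′`, `evenNum′ ++ common′` and `oddNum ++ common`: each generating function is
-- one piece of a dissection over a common denominator.
clearing↭₈ : clearing ↭ kinds col₈ 60 ++ (oddNum′ ++ common′)
clearing↭₈ = sort-≡⇒↭ ≡.refl

clearing↭₉ : clearing ↭ kinds col₉ 60 ++ (evenNum′ ++ common′)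
clearing↭₉ = sort-≡⇒↭ ≡.refl

clearing↭₁₀ : clearing ↭ kinds col₁₀ 60 ++ (oddNum ++ common)
clearing↭₁₀ = sort-≡⇒↭ ≡.refl

-- `common` and `common′` are disjoint, so they are exactly the two multiset differences between
-- `negNum′` and `negNum`. `common` holds the classes of P₈ other than ±10 and ±24, `common′` those
-- of P₇ other than ±10 and ±12; together they are the classes modulo 60 not divisible by 5.
negNum↭negNum′ : negNum ++ common ↭ negNum′ ++ common′
negNum↭negNum′ = sort-≡⇒↭ ≡.refl

-- Products and theta series of nilpotent elements

module ThetaFunctions {c ℓ} (R : CommutativeRing c ℓ) (L : ℕ) where

  open CommutativeRing R hiding (zero)
  open import Algebra.Properties.CommutativeSemiring.Exp commutativeSemiring
  open import Algebra.Properties.Ring ring using (-‿distribˡ-*; -‿distribʳ-*; -0#≈0#; -‿involutive)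
  open import Algebra.Solver.Ring.NaturalCoefficients.Default commutativeSemiring
    using (_:+_; _:*_; _:=_; con) renaming (solve to solveˢ)
  open import Relation.Binary.Reasoning.Setoid setoid

  -- Nilpotent elements and units

  Nil : Carrier → Set ℓ
  Nil y = y ^ L ≈ 0#

  nil-cong : ∀ {y z} → y ≈ z → Nil y → Nil z
  nil-cong y≈z yᴸ≈0 = trans (^-congˡ L (sym y≈z)) yᴸ≈0

  nil-* : ∀ {y} z → Nil y → Nil (y * z)
  nil-* {y} z yᴸ≈0 = trans (^-distrib-* y z L) (trans (*-congʳ yᴸ≈0) (zeroˡ _))

  nil-^ : ∀ {y n} → Nil y → L ℕ.≤ n → y ^ n ≈ 0#
  nil-^ {y} {n} yᴸ≈0 L≤n = begin
    y ^ n                     ≡⟨ ≡.cong (y ^_) (≡.sym (ℕₚ.m+[n∸m]≡n L≤n)) ⟩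
    y ^ (L ℕ.+ (n ℕ.∸ L))     ≈⟨ ^-homo-* y L (n ℕ.∸ L) ⟩
    y ^ L * y ^ (n ℕ.∸ L)     ≈⟨ *-congʳ yᴸ≈0 ⟩
    0# * y ^ (n ℕ.∸ L)        ≈⟨ zeroˡ _ ⟩
    0#                        ∎

  1+0≈1 : ∀ {y} → y ≈ 0# → 1# + y ≈ 1#
  1+0≈1 y≈0 = trans (+-congˡ y≈0) (+-identityʳ 1#)

  1-0≈1 : ∀ {y} → y ≈ 0# → 1# - y ≈ 1#
  1-0≈1 y≈0 = 1+0≈1 (trans (-‿cong y≈0) -0#≈0#)

  Unit : Carrier → Set _
  Unit y = ∃ λ z → y * z ≈ 1#

  unit-cancel : ∀ {u} → Unit u → ∀ {y z} → u * y ≈ u * z → y ≈ z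
  unit-cancel {u} (v , uv≈1) {y} {z} uy≈uz = begin
    y            ≈⟨ insert y ⟩
    v * (u * y)  ≈⟨ *-congˡ uy≈uz ⟩
    v * (u * z)  ≈⟨ insert z ⟨
    z            ∎
    where
    insert : ∀ w → w ≈ v * (u * w)
    insert w = begin
      w            ≈⟨ *-identityˡ w ⟨
      1# * w       ≈⟨ *-congʳ uv≈1 ⟨
      u * v * w    ≈⟨ solveˢ 3 (λ u v w → u :* v :* w := v :* (u :* w)) refl u v w ⟩
      v * (u * w)  ∎

  unit-* : ∀ {y z} → Unit y → Unit z → Unit (y * z)
  unit-* {y} {z} (y⁻¹ , eq) (z⁻¹ , eq′) = y⁻¹ * z⁻¹ , (begin
    y * z * (y⁻¹ * z⁻¹)      ≈⟨ solveˢ 4 (λ y z u v → y :* z :* (u :* v) := y :* u :* (z :* v)) refl y z y⁻¹ z⁻¹ ⟩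
    y * y⁻¹ * (z * z⁻¹)      ≈⟨ *-cong eq eq′ ⟩
    1# * 1#                  ≈⟨ *-identityˡ 1# ⟩
    1#                       ∎)

  unit-1-nil : ∀ {y} → Nil y → Unit (1# - y)
  unit-1-nil {y} yᴸ≈0 = geometric L , (begin
    (1# - y) * geometric L          ≈⟨ +-identityʳ _ ⟨
    (1# - y) * geometric L + 0#     ≈⟨ +-congˡ yᴸ≈0 ⟨
    (1# - y) * geometric L + y ^ L  ≈⟨ telescope L ⟩
    1#                              ∎)
    where
    geometric : ℕ → Carrier
    geometric zero    = 0#
    geometric (suc n) = geometric n + y ^ n
    telescope : ∀ n → (1# - y) * geometric n + y ^ n ≈ 1#
    telescope zero    = trans (+-congʳ (zeroʳ _)) (+-identityˡ 1#)
    telescope (suc n) = begin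
      (1# - y) * (geometric n + y ^ n) + y * y ^ n
        -- The solver works in a commutative semiring, so `- y` enters as an independent variable
        -- and the surplus multiple of `- y + y` is cancelled by hand.
        ≈⟨ solveˢ 4 (λ y y′ s p → (con 1 :+ y′) :* (s :+ p) :+ y :* p
                               := ((con 1 :+ y′) :* s :+ p) :+ (y′ :+ y) :* p)
                   refl y (- y) (geometric n) (y ^ n) ⟩
      ((1# - y) * geometric n + y ^ n) + (- y + y) * y ^ n
        ≈⟨ +-cong (telescope n) (trans (*-congʳ (-‿inverseˡ y)) (zeroˡ _)) ⟩
      1# + 0#
        ≈⟨ +-identityʳ 1# ⟩
      1#  ∎

  -- Finite products

  prod : ℕ → (ℕ → Carrier) → Carrier
  prod zero    f = 1#
  prod (suc n) f = prod n f * f n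

  prod-cong : ∀ n {f g} → (∀ k → f k ≈ g k) → prod n f ≈ prod n g
  prod-cong zero    f≈g = refl
  prod-cong (suc n) f≈g = *-cong (prod-cong n f≈g) (f≈g n)

  prod-* : ∀ n f g → prod n (λ k → f k * g k) ≈ prod n f * prod n g
  prod-* zero    f g = sym (*-identityˡ 1#)
  prod-* (suc n) f g = trans (*-congʳ (prod-* n f g))
    (solveˢ 4 (λ a b c d → a :* b :* (c :* d) := a :* c :* (b :* d)) refl _ _ _ _)

  prod-unit : ∀ n {f} → (∀ k → Unit (f k)) → Unit (prod n f)
  prod-unit zero    u = 1# , *-identityˡ 1#
  prod-unit (suc n) u = unit-* (prod-unit n u) (u n)

  prod-front : ∀ n f → prod (suc n) f ≈ f 0 * prod n (f ∘ suc)
  prod-front zero    f = *-comm 1# (f 0)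
  prod-front (suc n) f = trans (*-congʳ (prod-front n f)) (*-assoc _ _ _)

  prod-parity : ∀ n f → prod (n ℕ.* 2) f ≈ prod n (λ k → f (k ℕ.* 2)) * prod n (λ k → f (suc (k ℕ.* 2)))
  prod-parity zero    f = sym (*-identityˡ 1#)
  prod-parity (suc n) f = trans (*-congʳ (*-congʳ (prod-parity n f)))
    (solveˢ 4 (λ a b c d → a :* b :* c :* d := a :* c :* (b :* d)) refl _ _ _ _)

  prod-truncate : ∀ {n f} → (∀ k → L ℕ.≤ k → f k ≈ 1#) → L ℕ.≤ n → prod n f ≈ prod L f
  prod-truncate {n} {f} f≈1 L≤n =
    trans (reflexive (≡.cong (λ m → prod m f) (≡.sym (ℕₚ.m∸n+n≡m L≤n)))) (extend (n ℕ.∸ L))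
    where
    extend : ∀ d → prod (d ℕ.+ L) f ≈ prod L f
    extend zero    = refl
    extend (suc d) = trans (*-cong (extend d) (f≈1 (d ℕ.+ L) (ℕₚ.m≤n+m L d))) (*-identityʳ _)

  -- Sums over the half-open range -n ≤ k < n of integers

  sumℤ : ℕ → (ℤ → Carrier) → Carrier
  sumℤ zero    f = 0#
  sumℤ (suc n) f = sumℤ n f + (f (+ n) + f -[1+ n ])

  sumℤ-cong : ∀ n {f g} → (∀ k → ∣ k ∣ ℕ.≤ n → f k ≈ g k) → sumℤ n f ≈ sumℤ n g
  sumℤ-cong zero    f≈g = refl
  sumℤ-cong (suc n) f≈g = +-cong (sumℤ-cong n (λ k k≤n → f≈g k (ℕₚ.m≤n⇒m≤1+n k≤n)))
    (+-cong (f≈g (+ n) (ℕₚ.n≤1+n n)) (f≈g -[1+ n ] ℕₚ.≤-refl))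

  sumℤ-0 : ∀ n {f} → (∀ k → f k ≈ 0#) → sumℤ n f ≈ 0#
  sumℤ-0 zero    f≈0 = refl
  sumℤ-0 (suc n) f≈0 = trans (+-cong (sumℤ-0 n f≈0) (trans (+-cong (f≈0 _) (f≈0 _)) (+-identityʳ 0#))) (+-identityʳ 0#)

  sumℤ-+ : ∀ n f g → sumℤ n (λ k → f k + g k) ≈ sumℤ n f + sumℤ n g
  sumℤ-+ zero    f g = sym (+-identityˡ 0#)
  sumℤ-+ (suc n) f g = trans (+-congʳ (sumℤ-+ n f g))
    (solveˢ 6 (λ s t a b c d → s :+ t :+ ((a :+ b) :+ (c :+ d)) := s :+ (a :+ c) :+ (t :+ (b :+ d))) refl _ _ _ _ _ _)

  sumℤ-*ˡ : ∀ n y f → y * sumℤ n f ≈ sumℤ n (λ k → y * f k)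
  sumℤ-*ˡ zero    y f = zeroʳ y
  sumℤ-*ˡ (suc n) y f = trans (distribˡ y _ _) (+-cong (sumℤ-*ˡ n y f) (distribˡ y _ _))

  sumℤ-swap : ∀ m n (f : ℤ → ℤ → Carrier) →
              sumℤ m (λ j → sumℤ n (λ k → f j k)) ≈ sumℤ n (λ k → sumℤ m (λ j → f j k))
  sumℤ-swap zero    n f = sym (sumℤ-0 n (λ _ → refl))
  sumℤ-swap (suc m) n f = begin
    sumℤ m (λ j → sumℤ n (f j)) + (sumℤ n (f (+ m)) + sumℤ n (f -[1+ m ]))
      ≈⟨ +-cong (sumℤ-swap m n f) (sym (sumℤ-+ n (f (+ m)) (f -[1+ m ]))) ⟩
    sumℤ n (λ k → sumℤ m (λ j → f j k)) + sumℤ n (λ k → f (+ m) k + f -[1+ m ] k)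
      ≈⟨ sumℤ-+ n _ _ ⟨
    sumℤ n (λ k → sumℤ (suc m) (λ j → f j k))  ∎

  -- The half-open range pays off here: 2r and 2r + 1 for -n ≤ r < n cover -2n ≤ k < 2n exactly,
  -- without boundary terms.
  sumℤ-parity : ∀ n f → sumℤ (n ℕ.* 2) f ≈ sumℤ n (λ r → f (r ℤ.+ r)) + sumℤ n (λ r → f (ℤ.suc (r ℤ.+ r)))
  sumℤ-parity zero    f = sym (+-identityˡ 0#)
  sumℤ-parity (suc n) f = begin
    sumℤ (n ℕ.* 2) f + (f (+ (n ℕ.* 2)) + f -[1+ n ℕ.* 2 ]) + (f (+ suc (n ℕ.* 2)) + f -[1+ suc (n ℕ.* 2) ])
      ≈⟨ +-cong (+-cong (sumℤ-parity n f) (+-cong (at (λ k → + k)) (at -[1+_]))) (+-cong (at (λ k → + suc k)) (at (λ k → -[1+ suc k ]))) ⟩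
    _ + _ + (f (+ (n ℕ.+ n)) + f -[1+ n ℕ.+ n ]) + (f (+ suc (n ℕ.+ n)) + f -[1+ suc (n ℕ.+ n) ])
      ≈⟨ solveˢ 6 (λ s t a b c d → s :+ t :+ (a :+ b) :+ (c :+ d) := s :+ (a :+ d) :+ (t :+ (c :+ b))) refl _ _ _ _ _ _ ⟩
    _  ∎
    where
    at : (g : ℕ → ℤ) → f (g (n ℕ.* 2)) ≈ f (g (n ℕ.+ n))
    at g = reflexive (≡.cong (f ∘ g) (≡.trans (ℕₚ.*-comm n 2) (≡.cong (n ℕ.+_) (ℕₚ.+-identityʳ n))))

  -- Both sides are the sum of `f` over the closed range from -n to n.
  sumℤ-suc : ∀ n f → sumℤ n (f ∘ ℤ.suc) + f (ℤ.- + n) ≈ sumℤ n f + f (+ n)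
  sumℤ-suc zero    f = refl
  sumℤ-suc (suc n) f = begin
    sumℤ n (f ∘ ℤ.suc) + (f (+ suc n) + f (ℤ.suc -[1+ n ])) + f -[1+ n ]
      ≈⟨ +-congʳ (+-congˡ (+-congˡ (reflexive (≡.cong f (suc-neg n))))) ⟩
    sumℤ n (f ∘ ℤ.suc) + (f (+ suc n) + f (ℤ.- + n)) + f -[1+ n ]
      ≈⟨ solveˢ 4 (λ s a b c → s :+ (a :+ b) :+ c := (s :+ b) :+ c :+ a) refl _ _ _ _ ⟩
    (sumℤ n (f ∘ ℤ.suc) + f (ℤ.- + n)) + f -[1+ n ] + f (+ suc n)
      ≈⟨ +-congʳ (+-congʳ (sumℤ-suc n f)) ⟩
    (sumℤ n f + f (+ n)) + f -[1+ n ] + f (+ suc n)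
      ≈⟨ +-congʳ (+-assoc _ _ _) ⟩
    sumℤ (suc n) f + f (+ suc n)  ∎
    where
    suc-neg : ∀ n → ℤ.suc -[1+ n ] ≡ ℤ.- + n
    suc-neg zero    = ≡.refl
    suc-neg (suc n) = ≡.refl

  sumℤ-suc₀ : ∀ n f → f (ℤ.- + n) ≈ 0# → f (+ n) ≈ 0# → sumℤ n (f ∘ ℤ.suc) ≈ sumℤ n f
  sumℤ-suc₀ n f f₋≈0 f₊≈0 = begin
    sumℤ n (f ∘ ℤ.suc)                ≈⟨ +-identityʳ _ ⟨
    sumℤ n (f ∘ ℤ.suc) + 0#           ≈⟨ +-congˡ f₋≈0 ⟨
    sumℤ n (f ∘ ℤ.suc) + f (ℤ.- + n)  ≈⟨ sumℤ-suc n f ⟩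
    sumℤ n f + f (+ n)                ≈⟨ +-congˡ f₊≈0 ⟩
    sumℤ n f + 0#                     ≈⟨ +-identityʳ _ ⟩
    sumℤ n f                          ∎

  Supported : (ℤ → Carrier) → Set ℓ
  Supported f = ∀ k → L ℕ.≤ ∣ k ∣ → f k ≈ 0#

  sumℤ-truncate : ∀ {n f} → Supported f → L ℕ.≤ n → sumℤ n f ≈ sumℤ L f
  sumℤ-truncate {n} {f} f≈0 L≤n =
    trans (reflexive (≡.cong (λ m → sumℤ m f) (≡.sym (ℕₚ.m∸n+n≡m L≤n)))) (extend (n ℕ.∸ L))
    where
    extend : ∀ d → sumℤ (d ℕ.+ L) f ≈ sumℤ L f
    extend zero    = refl
    extend (suc d) = begin
      sumℤ (d ℕ.+ L) f + (f (+ (d ℕ.+ L)) + f -[1+ d ℕ.+ L ])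
        ≈⟨ +-cong (extend d) (+-cong (f≈0 _ (ℕₚ.m≤n+m L d)) (f≈0 _ (ℕₚ.m≤n+m L (suc d)))) ⟩
      sumℤ L f + (0# + 0#)
        ≈⟨ trans (+-congˡ (+-identityʳ 0#)) (+-identityʳ _) ⟩
      sumℤ L f  ∎

  -- The shift is made one unit at a time. The bound keeps both boundary indices of every step at
  -- distance at least L from 0, where `f` vanishes.
  sumℤ-shift : ∀ {n f} → Supported f → ∀ k → L ℕ.+ ∣ k ∣ ℕ.≤ n → sumℤ n (λ j → f (j ℤ.+ k)) ≈ sumℤ n f
  sumℤ-shift {n} {f} f≈0 = shift
    where
    far : ∀ i k → ∣ i ∣ ≡ n → L ℕ.+ ∣ k ∣ ℕ.≤ n → L ℕ.≤ ∣ i ℤ.+ k ∣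
    far i k ∣i∣≡n L+k≤n = ℕₚ.+-cancelʳ-≤ _ _ _ (ℕₚ.≤-trans L+k≤n (≡.subst (λ m → m ℕ.≤ _) ∣i∣≡n
      (≡.subst (λ j → ∣ j ∣ ℕ.≤ ∣ i ℤ.+ k ∣ ℕ.+ ∣ k ∣) (cancel i k) (ℤₚ.∣i-j∣≤∣i∣+∣j∣ (i ℤ.+ k) k))))
      where
      cancel : ∀ i k → (i ℤ.+ k) ℤ.- k ≡ i
      cancel = solve-∀
    step : ∀ k → L ℕ.+ ∣ k ∣ ℕ.≤ n → sumℤ n (λ j → f (j ℤ.+ ℤ.suc k)) ≈ sumℤ n (λ j → f (j ℤ.+ k))
    step k L+k≤n = trans
      (sumℤ-cong n (λ j _ → reflexive (≡.cong f (assoc j k))))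
      (sumℤ-suc₀ n (λ j → f (j ℤ.+ k))
        (f≈0 _ (far (ℤ.- + n) k (ℤₚ.∣-i∣≡∣i∣ (+ n)) L+k≤n)) (f≈0 _ (far (+ n) k ≡.refl L+k≤n)))
      where
      assoc : ∀ j k → j ℤ.+ (+ 1 ℤ.+ k) ≡ (+ 1 ℤ.+ j) ℤ.+ k
      assoc = solve-∀
    unshifted : sumℤ n (λ j → f (j ℤ.+ + 0)) ≈ sumℤ n f
    unshifted = sumℤ-cong n (λ j _ → reflexive (≡.cong f (ℤₚ.+-identityʳ j)))
    weaken : ∀ k → L ℕ.+ suc k ℕ.≤ n → L ℕ.+ k ℕ.≤ n
    weaken k = ℕₚ.≤-trans (ℕₚ.+-monoʳ-≤ L (ℕₚ.n≤1+n k))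
    shift : ∀ k → L ℕ.+ ∣ k ∣ ℕ.≤ n → sumℤ n (λ j → f (j ℤ.+ k)) ≈ sumℤ n f
    shift (+ zero)     le = unshifted
    shift (+ suc k)    le = trans (step (+ k) (weaken k le)) (shift (+ k) (weaken k le))
    shift -[1+ zero ]  le = trans (sym (step -[1+ 0 ] le)) unshifted
    shift -[1+ suc k ] le = trans (sym (step -[1+ suc k ] le)) (shift -[1+ k ] (weaken (suc k) le))

  -- Truncation of (-a; x)_∞.
  poch : Carrier → Carrier → Carrier
  poch a x = prod L (λ k → 1# + a * x ^ k)

  thetaTerm : Carrier → Carrier → ℤ → Carrier
  thetaTerm a b n = a ^ expᵃ n * b ^ expᵇ n

  theta : Carrier → Carrier → Carrier
  theta a b = sumℤ L (thetaTerm a b)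

  -- For n ≥ 0 the exponent of a is at least n, and for n < 0 the exponent of b is at least |n|.
  thetaTerm-supported : ∀ {a b} → Nil a → Nil b → Supported (thetaTerm a b)
  thetaTerm-supported nilᵃ nilᵇ (+ n)    L≤n =
    trans (*-congʳ (nil-^ nilᵃ (ℕₚ.≤-trans L≤n (n≤choose₂[1+n] n)))) (zeroˡ _)
  thetaTerm-supported nilᵃ nilᵇ -[1+ n ] L≤n =
    trans (*-congˡ (nil-^ nilᵇ (ℕₚ.≤-trans L≤n (n≤choose₂[1+n] (suc n))))) (zeroʳ _)

  -- The Jacobi triple product, through a finite form

  module TripleProduct (a b : Carrier) (nilᵃ : Nil a) (nilᵇ : Nil b) where

    x : Carrier
    x = a * b

    nilˣ : Nil x
    nilˣ = nil-* b nilᵃ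

    term : ℤ → Carrier
    term = thetaTerm a b

    monomials : ∀ i j k l {m n} → i ℕ.+ j ≡ m → k ℕ.+ l ≡ n →
                a ^ i * b ^ k * (a ^ j * b ^ l) ≈ a ^ m * b ^ n
    monomials i j k l ≡.refl ≡.refl = begin
      a ^ i * b ^ k * (a ^ j * b ^ l)    ≈⟨ solveˢ 4 (λ p q r s → p :* q :* (r :* s) := p :* r :* (q :* s)) refl _ _ _ _ ⟩
      a ^ i * a ^ j * (b ^ k * b ^ l)    ≈⟨ *-cong (^-homo-* a i j) (^-homo-* b k l) ⟨
      a ^ (i ℕ.+ j) * b ^ (k ℕ.+ l)      ∎

    -- Formally, consecutive terms have the ratio a x^n. Since a and b have no inverses, the
    -- relation is multiplied by x^p with p = M - n ≥ 0.
    term-suc : ∀ M p n → + M ≡ n ℤ.+ + p → a * x ^ M * term n ≈ x ^ p * term (ℤ.suc n)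
    term-suc M p n M≡n+p = begin
      a * x ^ M * term n
        ≈⟨ *-congʳ (trans (*-congˡ (^-distrib-* a b M)) (sym (*-assoc _ _ _))) ⟩
      a ^ suc M * b ^ M * term n
        ≈⟨ monomials (suc M) (expᵃ n) M (expᵇ n) ≡.refl ≡.refl ⟩
      a ^ (suc M ℕ.+ expᵃ n) * b ^ (M ℕ.+ expᵇ n)
        ≈⟨ monomials p (expᵃ (ℤ.suc n)) p (expᵇ (ℤ.suc n))
             (exponent-≡ (const p ⊕ triᵃ (ℤ.suc n)) (const (suc M) ⊕ triᵃ n)
               (≡.sym (≡.trans (≡.cong (λ m → + 2 ℤ.* (+ 1 ℤ.+ m) ℤ.+ n ℤ.* (n ℤ.+ + 1)) M≡n+p) (eqᵃ n (+ p)))))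
             (exponent-≡ (const p ⊕ triᵇ (ℤ.suc n)) (const M ⊕ triᵇ n)
               (≡.sym (≡.trans (≡.cong (λ m → + 2 ℤ.* m ℤ.+ n ℤ.* (n ℤ.- + 1)) M≡n+p) (eqᵇ n (+ p))))) ⟨
      a ^ p * b ^ p * term (ℤ.suc n)
        ≈⟨ *-congʳ (^-distrib-* a b p) ⟨
      x ^ p * term (ℤ.suc n)  ∎
      where
      eqᵃ : ∀ n p → + 2 ℤ.* (+ 1 ℤ.+ (n ℤ.+ p)) ℤ.+ n ℤ.* (n ℤ.+ + 1) ≡ + 2 ℤ.* p ℤ.+ (+ 1 ℤ.+ n) ℤ.* ((+ 1 ℤ.+ n) ℤ.+ + 1)
      eqᵃ = solve-∀
      eqᵇ : ∀ n p → + 2 ℤ.* (n ℤ.+ p) ℤ.+ n ℤ.* (n ℤ.- + 1) ≡ + 2 ℤ.* p ℤ.+ (+ 1 ℤ.+ n) ℤ.* ((+ 1 ℤ.+ n) ℤ.- + 1)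
      eqᵇ = solve-∀

    -- The ratio of the (n-1)-st term to the n-th is formally b x^(-n), multiplied here by x^p with
    -- p = N + n ≥ 0.
    term-pred : ∀ N p n → + N ≡ + p ℤ.- n → b * x ^ N * term n ≈ x ^ p * term (ℤ.pred n)
    term-pred N p n N≡p-n = begin
      b * x ^ N * term n
        ≈⟨ *-congʳ (trans (*-congˡ (^-distrib-* a b N)) (solveˢ 3 (λ b p q → b :* (p :* q) := p :* (b :* q)) refl _ _ _)) ⟩
      a ^ N * b ^ suc N * term n
        ≈⟨ monomials N (expᵃ n) (suc N) (expᵇ n) ≡.refl ≡.refl ⟩
      a ^ (N ℕ.+ expᵃ n) * b ^ (suc N ℕ.+ expᵇ n)
        ≈⟨ monomials p (expᵃ (ℤ.pred n)) p (expᵇ (ℤ.pred n))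
             (exponent-≡ (const p ⊕ triᵃ (ℤ.pred n)) (const N ⊕ triᵃ n)
               (≡.sym (≡.trans (≡.cong (λ m → + 2 ℤ.* m ℤ.+ n ℤ.* (n ℤ.+ + 1)) N≡p-n) (eqᵃ n (+ p)))))
             (exponent-≡ (const p ⊕ triᵇ (ℤ.pred n)) (const (suc N) ⊕ triᵇ n)
               (≡.sym (≡.trans (≡.cong (λ m → + 2 ℤ.* (+ 1 ℤ.+ m) ℤ.+ n ℤ.* (n ℤ.- + 1)) N≡p-n) (eqᵇ n (+ p))))) ⟨
      a ^ p * b ^ p * term (ℤ.pred n)
        ≈⟨ *-congʳ (^-distrib-* a b p) ⟨
      x ^ p * term (ℤ.pred n)  ∎
      where
      eqᵃ : ∀ n p → + 2 ℤ.* (p ℤ.- n) ℤ.+ n ℤ.* (n ℤ.+ + 1) ≡ + 2 ℤ.* p ℤ.+ (-[1+ 0 ] ℤ.+ n) ℤ.* ((-[1+ 0 ] ℤ.+ n) ℤ.+ + 1)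
      eqᵃ = solve-∀
      eqᵇ : ∀ n p → + 2 ℤ.* (+ 1 ℤ.+ (p ℤ.- n)) ℤ.+ n ℤ.* (n ℤ.- + 1) ≡ + 2 ℤ.* p ℤ.+ (-[1+ 0 ] ℤ.+ n) ℤ.* ((-[1+ 0 ] ℤ.+ n) ℤ.- + 1)
      eqᵇ = solve-∀

    tail : ℕ → Carrier
    tail m = prod L (λ i → 1# - x ^ suc (m ℕ.+ i))

    factor≈1 : ∀ {k} → L ℕ.≤ k → 1# - x ^ suc k ≈ 1#
    factor≈1 {k} L≤k = 1-0≈1 (nil-^ nilˣ (ℕₚ.m≤n⇒m≤1+n L≤k))

    tail-step : ∀ m → tail m ≈ (1# - x ^ suc m) * tail (suc m)
    tail-step m = begin
      prod L F                       ≈⟨ *-identityʳ _ ⟨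
      prod L F * 1#                  ≈⟨ *-congˡ (factor≈1 (ℕₚ.m≤n+m L m)) ⟨
      prod (suc L) F                 ≈⟨ prod-front L F ⟩
      F 0 * prod L (F ∘ suc)         ≈⟨ *-cong (same (ℕₚ.+-identityʳ m)) (prod-cong L (λ i → same (ℕₚ.+-suc m i))) ⟩
      (1# - x ^ suc m) * tail (suc m)  ∎
      where
      F : ℕ → Carrier
      F i = 1# - x ^ suc (m ℕ.+ i)
      same : ∀ {i j} → i ≡ j → 1# - x ^ suc i ≈ 1# - x ^ suc j
      same eq = reflexive (≡.cong (λ i → 1# - x ^ suc i) eq)

    tail≈1 : ∀ {m} → L ℕ.≤ m → tail m ≈ 1#
    tail≈1 {m} L≤m = ones L
      where
      ones : ∀ n → prod n (λ i → 1# - x ^ suc (m ℕ.+ i)) ≈ 1#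
      ones zero    = refl
      ones (suc n) = trans (*-cong (ones n) (factor≈1 (ℕₚ.≤-trans L≤m (ℕₚ.m≤m+n m n)))) (*-identityʳ 1#)

    -- The value 0 at negative indices is the convention 1 / (x; x)_m = 0 for m < 0; it lets the sum
    -- over n run past the range of the q-binomial coefficient.
    tailℤ : ℤ → Carrier
    tailℤ (+ p)    = tail p
    tailℤ -[1+ _ ] = 0#

    -- x^u * tailℤ u, with x^u left undefined for u < 0.
    weightedTail : ℤ → Carrier
    weightedTail (+ p)    = x ^ p * tail p
    weightedTail -[1+ _ ] = 0#

    tailℤ-pred : ∀ p → tailℤ (ℤ.pred (+ p)) ≈ (1# - x ^ p) * tail p
    tailℤ-pred zero    = sym (trans (*-congʳ (-‿inverseʳ 1#)) (zeroˡ _))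
    tailℤ-pred (suc p) = tail-step p

    tailℤ-neg : ∀ {i} → i ℤ.< + 0 → tailℤ i ≈ 0#
    tailℤ-neg ℤ.-<+ = refl
    tailℤ-neg (ℤ.+<+ ())

    weightedTail-neg : ∀ {i} → i ℤ.< + 0 → weightedTail i ≈ 0#
    weightedTail-neg ℤ.-<+ = refl
    weightedTail-neg (ℤ.+<+ ())

    1-x^[u+v] : ∀ u v → 1# - x ^ (u ℕ.+ v) ≈ (1# - x ^ u) + x ^ u * (1# - x ^ v)
    1-x^[u+v] u v = sym (begin
      (1# - x ^ u) + x ^ u * (1# - x ^ v)
        ≈⟨ solveˢ 3 (λ n p n′ → (con 1 :+ n) :+ p :* (con 1 :+ n′) := con 1 :+ ((n :+ p) :+ p :* n′)) refl (- (x ^ u)) (x ^ u) (- (x ^ v)) ⟩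
      1# + ((- (x ^ u) + x ^ u) + x ^ u * - (x ^ v))
        ≈⟨ +-congˡ (trans (+-congʳ (-‿inverseˡ _)) (+-identityˡ _)) ⟩
      1# + x ^ u * - (x ^ v)
        ≈⟨ +-congˡ (trans (-‿cong (^-homo-* x u v)) (-‿distribʳ-* _ _)) ⟨
      1# - x ^ (u ℕ.+ v)  ∎)

    -- The q-Pascal rule for products of tails: 1 - x^(u+v) = (1 - x^u) + x^u (1 - x^v), and each
    -- bracket lowers the index of one tail. At u = 0 or v = 0 the vanishing bracket matches the
    -- value 0 of `tailℤ` at -1.
    pascal : ∀ w u v → + w ≡ u ℤ.+ v →
             (1# - x ^ w) * (tailℤ u * tailℤ v) ≈ tailℤ (ℤ.pred u) * tailℤ v + weightedTail u * tailℤ (ℤ.pred v)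
    pascal w (+ u) (+ v) w≡u+v = begin
      (1# - x ^ w) * (tail u * tail v)
        ≈⟨ *-congʳ (trans (reflexive (≡.cong (λ w → 1# - x ^ w) (ℤₚ.+-injective w≡u+v))) (1-x^[u+v] u v)) ⟩
      ((1# - x ^ u) + x ^ u * (1# - x ^ v)) * (tail u * tail v)
        ≈⟨ solveˢ 5 (λ d p e s t → (d :+ p :* e) :* (s :* t) := d :* s :* t :+ p :* s :* (e :* t)) refl _ _ _ _ _ ⟩
      (1# - x ^ u) * tail u * tail v + x ^ u * tail u * ((1# - x ^ v) * tail v)
        ≈⟨ +-cong (*-congʳ (tailℤ-pred u)) (*-congˡ (tailℤ-pred v)) ⟨
      tailℤ (ℤ.pred (+ u)) * tail v + weightedTail (+ u) * tailℤ (ℤ.pred (+ v))  ∎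
    pascal w (+ u) -[1+ v ] _ = trans (trans (*-congˡ (zeroʳ _)) (zeroʳ _))
      (sym (trans (+-cong (zeroʳ _) (zeroʳ _)) (+-identityʳ 0#)))
    pascal w -[1+ u ] v _ = trans (trans (*-congˡ (zeroˡ _)) (zeroʳ _))
      (sym (trans (+-cong (zeroˡ _) (zeroˡ _)) (+-identityʳ 0#)))

    -- The expansion of ∏_{k<M} (1 + a x^k) ∏_{k<N} (1 + b x^k) with the q-binomial coefficient
    -- [M + N, N + n] = (x; x)_{M+N} / ((x; x)_{M-n} (x; x)_{N+n}) multiplied by
    -- (x; x)_∞² / (x; x)_{M+N}.
    H : ℕ → ℕ → ℕ → Carrier
    H M N K = sumℤ K (λ n → tailℤ (+ M ℤ.- n) * tailℤ (+ N ℤ.+ n) * term n)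

    below : ∀ {m n} → m ℕ.< n → + m ℤ.- + n ℤ.< + 0
    below {m} {n} m<n = ≡.subst (ℤ._< + 0) (≡.sym (ℤₚ.m-n≡m⊖n m n))
      (≡.subst (ℤ._< + 0) (≡.sym (ℤₚ.⊖-< m<n)) (negative (ℕₚ.m<n⇒0<n∸m m<n)))
      where
      negative : ∀ {k} → 0 ℕ.< k → ℤ.- + k ℤ.< + 0
      negative {suc k} _ = ℤ.-<+

    -- `pascal` splits each summand in two. The first halves add up to `H M N K`; the second halves,
    -- shifted by one index, are the summands of `H M N K` times a x^M. The bounds on `K` make both
    -- boundary terms of the shift vanish.
    H-sucˡ : ∀ M N K → suc M ℕ.< K → N ℕ.≤ K →
             (1# - x ^ suc (M ℕ.+ N)) * H (suc M) N K ≈ (1# + a * x ^ M) * H M N K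
    H-sucˡ M N K M<K N≤K = begin
      (1# - x ^ suc (M ℕ.+ N)) * H (suc M) N K
        ≈⟨ sumℤ-*ˡ K _ _ ⟩
      sumℤ K (λ n → (1# - x ^ suc (M ℕ.+ N)) * (tailℤ (+ suc M ℤ.- n) * tailℤ (+ N ℤ.+ n) * term n))
        ≈⟨ sumℤ-cong K (λ n _ → split n) ⟩
      sumℤ K (λ n → tailℤ (+ M ℤ.- n) * tailℤ (+ N ℤ.+ n) * term n + φ n)
        ≈⟨ sumℤ-+ K _ _ ⟩
      H M N K + sumℤ K φ
        ≈⟨ +-congˡ (sumℤ-suc₀ K φ φ₋≈0 φ₊≈0) ⟨
      H M N K + sumℤ K (φ ∘ ℤ.suc)
        ≈⟨ +-congˡ (sumℤ-cong K (λ n _ → absorb n)) ⟨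
      H M N K + sumℤ K (λ n → a * x ^ M * (tailℤ (+ M ℤ.- n) * tailℤ (+ N ℤ.+ n) * term n))
        ≈⟨ +-cong (*-identityˡ _) (sumℤ-*ˡ K _ _) ⟨
      1# * H M N K + a * x ^ M * H M N K
        ≈⟨ distribʳ _ _ _ ⟨
      (1# + a * x ^ M) * H M N K  ∎
      where
      φ : ℤ → Carrier
      φ n = weightedTail (+ suc M ℤ.- n) * tailℤ (+ N ℤ.+ ℤ.pred n) * term n

      φ₊≈0 : φ (+ K) ≈ 0#
      φ₊≈0 = trans (*-congʳ (trans (*-congʳ (weightedTail-neg (below M<K))) (zeroˡ _))) (zeroˡ _)

      φ₋≈0 : φ (ℤ.- + K) ≈ 0#
      φ₋≈0 = trans (*-congʳ (trans (*-congˡ (tailℤ-neg (≡.subst (ℤ._< + 0) (eq (+ N) (+ K)) (below (ℕ.s≤s N≤K))))) (zeroʳ _))) (zeroˡ _)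
        where
        eq : ∀ N K → N ℤ.- (+ 1 ℤ.+ K) ≡ N ℤ.+ (-[1+ 0 ] ℤ.+ ℤ.- K)
        eq = solve-∀

      split : ∀ n → (1# - x ^ suc (M ℕ.+ N)) * (tailℤ (+ suc M ℤ.- n) * tailℤ (+ N ℤ.+ n) * term n)
                    ≈ tailℤ (+ M ℤ.- n) * tailℤ (+ N ℤ.+ n) * term n + φ n
      split n = begin
        (1# - x ^ suc (M ℕ.+ N)) * (tailℤ (+ suc M ℤ.- n) * tailℤ (+ N ℤ.+ n) * term n)
          ≈⟨ *-assoc _ _ _ ⟨
        (1# - x ^ suc (M ℕ.+ N)) * (tailℤ (+ suc M ℤ.- n) * tailℤ (+ N ℤ.+ n)) * term n
          ≈⟨ *-congʳ (pascal (suc (M ℕ.+ N)) (+ suc M ℤ.- n) (+ N ℤ.+ n) (total (+ M) (+ N) n)) ⟩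
        (tailℤ (ℤ.pred (+ suc M ℤ.- n)) * tailℤ (+ N ℤ.+ n) + weightedTail (+ suc M ℤ.- n) * tailℤ (ℤ.pred (+ N ℤ.+ n))) * term n
          ≈⟨ distribʳ _ _ _ ⟩
        tailℤ (ℤ.pred (+ suc M ℤ.- n)) * tailℤ (+ N ℤ.+ n) * term n + weightedTail (+ suc M ℤ.- n) * tailℤ (ℤ.pred (+ N ℤ.+ n)) * term n
          ≡⟨ ≡.cong₂ (λ i j → tailℤ i * tailℤ (+ N ℤ.+ n) * term n + weightedTail (+ suc M ℤ.- n) * tailℤ j * term n)
               (predˡ (+ M) n) (predʳ (+ N) n) ⟩
        tailℤ (+ M ℤ.- n) * tailℤ (+ N ℤ.+ n) * term n + φ n  ∎
        where
        total : ∀ M N n → + 1 ℤ.+ (M ℤ.+ N) ≡ (+ 1 ℤ.+ M ℤ.- n) ℤ.+ (N ℤ.+ n)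
        total = solve-∀
        predˡ : ∀ M n → -[1+ 0 ] ℤ.+ ((+ 1 ℤ.+ M) ℤ.- n) ≡ M ℤ.- n
        predˡ = solve-∀
        predʳ : ∀ N n → -[1+ 0 ] ℤ.+ (N ℤ.+ n) ≡ N ℤ.+ (-[1+ 0 ] ℤ.+ n)
        predʳ = solve-∀

      absorb-at : ∀ i n y → i ≡ + M ℤ.- n → a * x ^ M * (tailℤ i * y * term n) ≈ weightedTail i * y * term (ℤ.suc n)
      absorb-at -[1+ p ] n y _ = trans (trans (*-congˡ (trans (*-congʳ (zeroˡ y)) (zeroˡ _))) (zeroʳ _))
                                       (sym (trans (*-congʳ (zeroˡ y)) (zeroˡ _)))
      absorb-at (+ p) n y p≡M-n = begin
        a * x ^ M * (tail p * y * term n)          ≈⟨ solveˢ 4 (λ w s y t → w :* (s :* y :* t) := w :* t :* (s :* y)) refl _ _ _ _ ⟩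
        a * x ^ M * term n * (tail p * y)          ≈⟨ *-congʳ (term-suc M p n (≡.trans (cancel (+ M) n) (≡.cong (λ i → n ℤ.+ i) (≡.sym p≡M-n)))) ⟩
        x ^ p * term (ℤ.suc n) * (tail p * y)      ≈⟨ solveˢ 4 (λ w t s y → w :* t :* (s :* y) := w :* s :* y :* t) refl _ _ _ _ ⟩
        x ^ p * tail p * y * term (ℤ.suc n)        ∎
        where
        cancel : ∀ M n → M ≡ n ℤ.+ (M ℤ.- n)
        cancel = solve-∀

      absorb : ∀ n → a * x ^ M * (tailℤ (+ M ℤ.- n) * tailℤ (+ N ℤ.+ n) * term n) ≈ φ (ℤ.suc n)
      absorb n = trans (absorb-at (+ M ℤ.- n) n _ ≡.refl)
        (reflexive (≡.cong₂ (λ i j → weightedTail i * tailℤ j * term (ℤ.suc n)) (eqˡ (+ M) n) (eqʳ (+ N) n)))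
        where
        eqˡ : ∀ M n → M ℤ.- n ≡ (+ 1 ℤ.+ M) ℤ.- (+ 1 ℤ.+ n)
        eqˡ = solve-∀
        eqʳ : ∀ N n → N ℤ.+ n ≡ N ℤ.+ (-[1+ 0 ] ℤ.+ (+ 1 ℤ.+ n))
        eqʳ = solve-∀

    H-sucʳ : ∀ M N K → M ℕ.< K → N ℕ.< K →
             (1# - x ^ suc (M ℕ.+ N)) * H M (suc N) K ≈ (1# + b * x ^ N) * H M N K
    H-sucʳ M N K M<K N<K = begin
      (1# - x ^ suc (M ℕ.+ N)) * H M (suc N) K
        ≈⟨ sumℤ-*ˡ K _ _ ⟩
      sumℤ K (λ n → (1# - x ^ suc (M ℕ.+ N)) * (tailℤ (+ M ℤ.- n) * tailℤ (+ suc N ℤ.+ n) * term n))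
        ≈⟨ sumℤ-cong K (λ n _ → split n) ⟩
      sumℤ K (λ n → tailℤ (+ M ℤ.- n) * tailℤ (+ N ℤ.+ n) * term n + φ n)
        ≈⟨ sumℤ-+ K _ _ ⟩
      H M N K + sumℤ K φ
        -- Here the index has to move down, so the shift lemma is applied to `φ ∘ ℤ.pred`, of which
        -- `φ` is the successor shift.
        ≈⟨ +-congˡ (sumℤ-cong K (λ n _ → reflexive (≡.cong φ (ℤₚ.pred-suc n)))) ⟨
      H M N K + sumℤ K (φ ∘ ℤ.pred ∘ ℤ.suc)
        ≈⟨ +-congˡ (sumℤ-suc₀ K (φ ∘ ℤ.pred) φ₋≈0 φ₊≈0) ⟩
      H M N K + sumℤ K (φ ∘ ℤ.pred)
        ≈⟨ +-congˡ (sumℤ-cong K (λ n _ → absorb n)) ⟨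
      H M N K + sumℤ K (λ n → b * x ^ N * (tailℤ (+ M ℤ.- n) * tailℤ (+ N ℤ.+ n) * term n))
        ≈⟨ +-cong (*-identityˡ _) (sumℤ-*ˡ K _ _) ⟨
      1# * H M N K + b * x ^ N * H M N K
        ≈⟨ distribʳ _ _ _ ⟨
      (1# + b * x ^ N) * H M N K  ∎
      where
      φ : ℤ → Carrier
      φ n = weightedTail (+ suc N ℤ.+ n) * tailℤ (ℤ.pred (+ M ℤ.- n)) * term n

      φ₊≈0 : φ (ℤ.pred (+ K)) ≈ 0#
      φ₊≈0 = trans (*-congʳ (trans (*-congˡ (tailℤ-neg (≡.subst (ℤ._< + 0) (eq (+ M) (+ K)) (below M<K)))) (zeroʳ _))) (zeroˡ _)
        where
        eq : ∀ M K → M ℤ.- K ≡ -[1+ 0 ] ℤ.+ (M ℤ.- (-[1+ 0 ] ℤ.+ K))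
        eq = solve-∀

      φ₋≈0 : φ (ℤ.pred (ℤ.- + K)) ≈ 0#
      φ₋≈0 = trans (*-congʳ (trans (*-congʳ (weightedTail-neg (≡.subst (ℤ._< + 0) (eq (+ N) (+ K)) (below N<K)))) (zeroˡ _))) (zeroˡ _)
        where
        eq : ∀ N K → N ℤ.- K ≡ (+ 1 ℤ.+ N) ℤ.+ (-[1+ 0 ] ℤ.+ ℤ.- K)
        eq = solve-∀

      split : ∀ n → (1# - x ^ suc (M ℕ.+ N)) * (tailℤ (+ M ℤ.- n) * tailℤ (+ suc N ℤ.+ n) * term n)
                    ≈ tailℤ (+ M ℤ.- n) * tailℤ (+ N ℤ.+ n) * term n + φ n
      split n = begin
        (1# - x ^ suc (M ℕ.+ N)) * (tailℤ (+ M ℤ.- n) * tailℤ (+ suc N ℤ.+ n) * term n)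
          ≈⟨ solveˢ 4 (λ d s s′ t → d :* (s :* s′ :* t) := d :* (s′ :* s) :* t) refl _ _ _ _ ⟩
        (1# - x ^ suc (M ℕ.+ N)) * (tailℤ (+ suc N ℤ.+ n) * tailℤ (+ M ℤ.- n)) * term n
          ≈⟨ *-congʳ (pascal (suc (M ℕ.+ N)) (+ suc N ℤ.+ n) (+ M ℤ.- n) (total (+ M) (+ N) n)) ⟩
        (tailℤ (ℤ.pred (+ suc N ℤ.+ n)) * tailℤ (+ M ℤ.- n) + weightedTail (+ suc N ℤ.+ n) * tailℤ (ℤ.pred (+ M ℤ.- n))) * term n
          ≈⟨ distribʳ _ _ _ ⟩
        tailℤ (ℤ.pred (+ suc N ℤ.+ n)) * tailℤ (+ M ℤ.- n) * term n + φ n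
          ≈⟨ +-congʳ (*-congʳ (trans (*-congʳ (reflexive (≡.cong tailℤ (predˡ (+ N) n)))) (*-comm _ _))) ⟩
        tailℤ (+ M ℤ.- n) * tailℤ (+ N ℤ.+ n) * term n + φ n  ∎
        where
        total : ∀ M N n → + 1 ℤ.+ (M ℤ.+ N) ≡ (+ 1 ℤ.+ N ℤ.+ n) ℤ.+ (M ℤ.- n)
        total = solve-∀
        predˡ : ∀ N n → -[1+ 0 ] ℤ.+ ((+ 1 ℤ.+ N) ℤ.+ n) ≡ N ℤ.+ n
        predˡ = solve-∀

      absorb-at : ∀ i n y → i ≡ + N ℤ.+ n → b * x ^ N * (y * tailℤ i * term n) ≈ weightedTail i * y * term (ℤ.pred n)
      absorb-at -[1+ p ] n y _ = trans (trans (*-congˡ (trans (*-congʳ (zeroʳ y)) (zeroˡ _))) (zeroʳ _))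
                                       (sym (trans (*-congʳ (zeroˡ y)) (zeroˡ _)))
      absorb-at (+ p) n y p≡N+n = begin
        b * x ^ N * (y * tail p * term n)          ≈⟨ solveˢ 4 (λ w s y t → w :* (y :* s :* t) := w :* t :* (s :* y)) refl _ _ _ _ ⟩
        b * x ^ N * term n * (tail p * y)          ≈⟨ *-congʳ (term-pred N p n (≡.trans (cancel (+ N) n) (≡.cong (λ i → i ℤ.- n) (≡.sym p≡N+n)))) ⟩
        x ^ p * term (ℤ.pred n) * (tail p * y)     ≈⟨ solveˢ 4 (λ w t s y → w :* t :* (s :* y) := w :* s :* y :* t) refl _ _ _ _ ⟩
        x ^ p * tail p * y * term (ℤ.pred n)       ∎
        where
        cancel : ∀ N n → N ≡ (N ℤ.+ n) ℤ.- n
        cancel = solve-∀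

      absorb : ∀ n → b * x ^ N * (tailℤ (+ M ℤ.- n) * tailℤ (+ N ℤ.+ n) * term n) ≈ φ (ℤ.pred n)
      absorb n = trans (absorb-at (+ N ℤ.+ n) n _ ≡.refl)
        (reflexive (≡.cong₂ (λ i j → weightedTail i * tailℤ j * term (ℤ.pred n)) (eqˡ (+ N) n) (eqʳ (+ M) n)))
        where
        eqˡ : ∀ N n → N ℤ.+ n ≡ (+ 1 ℤ.+ N) ℤ.+ (-[1+ 0 ] ℤ.+ n)
        eqˡ = solve-∀
        eqʳ : ∀ M n → M ℤ.- n ≡ -[1+ 0 ] ℤ.+ (M ℤ.- (-[1+ 0 ] ℤ.+ n))
        eqʳ = solve-∀

    -- Only n = 0 survives: otherwise one of the indices -n and n is negative and its tail is 0.
    H-00 : ∀ K → H 0 0 (suc K) ≈ tail 0 * tail 0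
    H-00 zero    = begin
      0# + (tail 0 * tail 0 * (1# * 1#) + tail 1 * 0# * (1# * (b * 1#)))
        ≈⟨ solveˢ 4 (λ s t u z → con 0 :+ (s :* s :* (con 1 :* con 1) :+ t :* con 0 :* u) := s :* s) refl (tail 0) (tail 1) _ 0# ⟩
      tail 0 * tail 0  ∎
    H-00 (suc K) = begin
      H 0 0 (suc K) + (0# * tail (suc K) * term (+ suc K) + tail (suc (suc K)) * 0# * term -[1+ suc K ])
        ≈⟨ +-cong (H-00 K) (solveˢ 4 (λ s t u v → con 0 :* s :* t :+ u :* con 0 :* v := con 0) refl _ _ _ _) ⟩
      tail 0 * tail 0 + 0#
        ≈⟨ +-identityʳ _ ⟩
      tail 0 * tail 0  ∎

    euler : ℕ → Carrier
    euler n = prod n (λ k → 1# - x ^ suc k)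

    -- Raising `M` or `N` by one trades the new factor 1 - x^(M+N+1) of `euler` for one new factor
    -- of the product in a or in b.
    finite-triple-product : ∀ M N K → M ℕ.< K → N ℕ.< K →
      euler (M ℕ.+ N) * H M N K ≈ prod M (λ k → 1# + a * x ^ k) * prod N (λ k → 1# + b * x ^ k) * (tail 0 * tail 0)
    finite-triple-product zero zero (suc K) _ _ = begin
      1# * H 0 0 (suc K)              ≈⟨ *-congˡ (H-00 K) ⟩
      1# * (tail 0 * tail 0)          ≈⟨ *-congʳ (*-identityˡ 1#) ⟨
      1# * 1# * (tail 0 * tail 0)     ∎
    finite-triple-product zero (suc N) K M<K N<K = begin
      euler N * (1# - x ^ suc N) * H 0 (suc N) K
        ≈⟨ *-assoc _ _ _ ⟩
      euler N * ((1# - x ^ suc N) * H 0 (suc N) K)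
        ≈⟨ *-congˡ (H-sucʳ 0 N K M<K (ℕₚ.<-trans (ℕₚ.n<1+n N) N<K)) ⟩
      euler N * ((1# + b * x ^ N) * H 0 N K)
        ≈⟨ solveˢ 3 (λ e f h → e :* (f :* h) := f :* (e :* h)) refl _ _ _ ⟩
      (1# + b * x ^ N) * (euler N * H 0 N K)
        ≈⟨ *-congˡ (finite-triple-product zero N K M<K (ℕₚ.<-trans (ℕₚ.n<1+n N) N<K)) ⟩
      (1# + b * x ^ N) * (1# * prod N (λ k → 1# + b * x ^ k) * (tail 0 * tail 0))
        ≈⟨ solveˢ 4 (λ f p q t → f :* (p :* q :* t) := p :* (q :* f) :* t) refl _ _ _ _ ⟩
      1# * prod (suc N) (λ k → 1# + b * x ^ k) * (tail 0 * tail 0)  ∎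
    finite-triple-product (suc M) N K M<K N<K = begin
      euler (M ℕ.+ N) * (1# - x ^ suc (M ℕ.+ N)) * H (suc M) N K
        ≈⟨ *-assoc _ _ _ ⟩
      euler (M ℕ.+ N) * ((1# - x ^ suc (M ℕ.+ N)) * H (suc M) N K)
        ≈⟨ *-congˡ (H-sucˡ M N K M<K (ℕₚ.<⇒≤ N<K)) ⟩
      euler (M ℕ.+ N) * ((1# + a * x ^ M) * H M N K)
        ≈⟨ solveˢ 3 (λ e f h → e :* (f :* h) := f :* (e :* h)) refl _ _ _ ⟩
      (1# + a * x ^ M) * (euler (M ℕ.+ N) * H M N K)
        ≈⟨ *-congˡ (finite-triple-product M N K (ℕₚ.<-trans (ℕₚ.n<1+n M) M<K) N<K) ⟩
      (1# + a * x ^ M) * (prod M (λ k → 1# + a * x ^ k) * prod N (λ k → 1# + b * x ^ k) * (tail 0 * tail 0))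
        ≈⟨ solveˢ 4 (λ f p q t → f :* (p :* q :* t) := p :* f :* q :* t) refl _ _ _ _ ⟩
      prod (suc M) (λ k → 1# + a * x ^ k) * prod N (λ k → 1# + b * x ^ k) * (tail 0 * tail 0)  ∎

    -- With both bounds equal to 2L, the tail indices 2L - n and 2L + n are at least L when |n| ≤ L,
    -- so the tails are 1; for |n| ≥ L the theta term itself is 0.
    H-limit : H (L ℕ.+ L) (L ℕ.+ L) (suc (L ℕ.+ L)) ≈ theta a b
    H-limit = trans (sumℤ-cong K λ n _ → pointwise n) (sumℤ-truncate (thetaTerm-supported nilᵃ nilᵇ) (ℕₚ.m≤n⇒m≤1+n (ℕₚ.m≤m+n L L)))
      where
      K = suc (L ℕ.+ L)
      near : ∀ n → ∣ n ∣ ℕ.≤ L → tailℤ (+ (L ℕ.+ L) ℤ.+ n) ≈ 1#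
      near (+ m)    _   = tail≈1 (ℕₚ.≤-trans (ℕₚ.m≤m+n L L) (ℕₚ.m≤m+n (L ℕ.+ L) m))
      near -[1+ m ] m<L = trans (reflexive (≡.cong tailℤ (ℤₚ.⊖-≥ (ℕₚ.≤-trans m<L (ℕₚ.m≤m+n L L)))))
        (tail≈1 (ℕₚ.m+n≤o⇒m≤o∸n L (ℕₚ.+-monoʳ-≤ L m<L)))
      pointwise : ∀ n → tailℤ (+ (L ℕ.+ L) ℤ.- n) * tailℤ (+ (L ℕ.+ L) ℤ.+ n) * term n ≈ term n
      pointwise n with L ℕₚ.≤? ∣ n ∣
      ... | yes L≤n = trans (*-congˡ (thetaTerm-supported nilᵃ nilᵇ n L≤n)) (trans (zeroʳ _) (sym (thetaTerm-supported nilᵃ nilᵇ n L≤n)))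
      ... | no  L≰n = begin
        tailℤ (+ (L ℕ.+ L) ℤ.- n) * tailℤ (+ (L ℕ.+ L) ℤ.+ n) * term n
          ≈⟨ *-congʳ (*-cong (near (ℤ.- n) (≡.subst (λ m → m ℕ.≤ L) (≡.sym (ℤₚ.∣-i∣≡∣i∣ n)) n≤L)) (near n n≤L)) ⟩
        1# * 1# * term n
          ≈⟨ trans (*-congʳ (*-identityˡ 1#)) (*-identityˡ _) ⟩
        term n  ∎
        where
        n≤L : ∣ n ∣ ℕ.≤ L
        n≤L = ℕₚ.<⇒≤ (ℕₚ.≰⇒> L≰n)

    unit-euler : Unit (tail 0)
    unit-euler = prod-unit L (λ k → unit-1-nil (nil-* (x ^ k) nilˣ))

    triple-product : poch a x * poch b x * poch (- x) x ≈ theta a b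
    triple-product = begin
      poch a x * poch b x * poch (- x) x
        ≈⟨ *-congˡ (prod-cong L (λ k → +-congˡ (sym (-‿distribˡ-* x (x ^ k))))) ⟩
      poch a x * poch b x * tail 0
        ≈⟨ unit-cancel unit-euler cancelled ⟩
      theta a b  ∎
      where
      D = L ℕ.+ L
      truncate : ∀ c → prod D (λ k → 1# + c * x ^ k) ≈ poch c x
      truncate c = prod-truncate (λ k L≤k → 1+0≈1 (trans (*-congˡ (nil-^ nilˣ L≤k)) (zeroʳ c))) (ℕₚ.m≤m+n L L)
      -- `euler` at D + D ≥ L is already the whole of (x; x)_∞, that is `tail 0`, so one of the two
      -- copies of this unit on the product side cancels.
      cancelled : tail 0 * (poch a x * poch b x * tail 0) ≈ tail 0 * theta a b
      cancelled = begin
        tail 0 * (poch a x * poch b x * tail 0)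
          ≈⟨ solveˢ 3 (λ t p q → t :* (p :* q :* t) := p :* q :* (t :* t)) refl _ _ _ ⟩
        poch a x * poch b x * (tail 0 * tail 0)
          ≈⟨ *-congʳ (*-cong (truncate a) (truncate b)) ⟨
        prod D (λ k → 1# + a * x ^ k) * prod D (λ k → 1# + b * x ^ k) * (tail 0 * tail 0)
          ≈⟨ finite-triple-product D D (suc D) (ℕₚ.n<1+n D) (ℕₚ.n<1+n D) ⟨
        euler (D ℕ.+ D) * H D D (suc D)
          ≈⟨ *-cong (prod-truncate (λ k → factor≈1) (ℕₚ.≤-trans (ℕₚ.m≤m+n L L) (ℕₚ.m≤m+n D D))) H-limit ⟩
        tail 0 * theta a b  ∎

  -- Parity dissection of a product of two theta series

  sumℤ-cauchy : ∀ m n f g → sumℤ m (λ r → sumℤ n (λ s → f r * g s)) ≈ sumℤ m f * sumℤ n g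
  sumℤ-cauchy m n f g = begin
    sumℤ m (λ r → sumℤ n (λ s → f r * g s))  ≈⟨ sumℤ-cong m (λ r _ → trans (sym (sumℤ-*ˡ n (f r) g)) (*-comm _ _)) ⟩
    sumℤ m (λ r → sumℤ n g * f r)            ≈⟨ sumℤ-*ˡ m (sumℤ n g) f ⟨
    sumℤ n g * sumℤ m f                      ≈⟨ *-comm _ _ ⟩
    sumℤ m f * sumℤ n g                      ∎

  -- The substitution (n, m) = (r + s, r - s) or (r + s + 1, r - s), according
  -- to the parity of n + m.
  sumℤ-dissect : ∀ {f g} → Supported f → Supported g →
    let P = suc (L ℕ.+ L); N = L ℕ.+ suc P in
    sumℤ L f * sumℤ L g ≈
      sumℤ P (λ r → sumℤ N (λ s → f (s ℤ.+ r) * g ((r ℤ.+ r) ℤ.- (s ℤ.+ r)))) +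
      sumℤ P (λ r → sumℤ N (λ s → f (s ℤ.+ ℤ.suc r) * g (ℤ.suc (r ℤ.+ r) ℤ.- (s ℤ.+ ℤ.suc r))))
  sumℤ-dissect {f} {g} suppᶠ suppᵍ = begin
    sumℤ L f * sumℤ L g
      ≈⟨ *-cong (sumℤ-truncate suppᶠ (ℕₚ.m≤m+n L (suc P))) (sumℤ-truncate suppᵍ L≤2P) ⟨
    sumℤ N f * sumℤ (P ℕ.* 2) g
      ≈⟨ sumℤ-cauchy N (P ℕ.* 2) f g ⟨
    sumℤ N (λ n → sumℤ (P ℕ.* 2) (λ m → f n * g m))
      ≈⟨ sumℤ-cong N (λ n n≤N → sym (sumℤ-shift (supportʳ n) (ℤ.- n) (shift≤2P n n≤N))) ⟩
    sumℤ N (λ n → sumℤ (P ℕ.* 2) (λ d → f n * g (d ℤ.- n)))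
      ≈⟨ sumℤ-swap N (P ℕ.* 2) _ ⟩
    sumℤ (P ℕ.* 2) (λ d → sumℤ N (λ n → f n * g (d ℤ.- n)))
      ≈⟨ sumℤ-parity P _ ⟩
    sumℤ P (λ r → sumℤ N (λ n → f n * g ((r ℤ.+ r) ℤ.- n))) + sumℤ P (λ r → sumℤ N (λ n → f n * g (ℤ.suc (r ℤ.+ r) ℤ.- n)))
      ≈⟨ +-cong (sumℤ-cong P (λ r r≤P → sym (sumℤ-shift (supportˡ (r ℤ.+ r)) r (ℕₚ.+-monoʳ-≤ L (ℕₚ.m≤n⇒m≤1+n r≤P)))))
                (sumℤ-cong P (λ r r≤P → sym (sumℤ-shift (supportˡ (ℤ.suc (r ℤ.+ r))) (ℤ.suc r)
                                              (ℕₚ.+-monoʳ-≤ L (ℕₚ.≤-trans (ℤₚ.∣i+j∣≤∣i∣+∣j∣ (+ 1) r) (ℕ.s≤s r≤P)))))) ⟩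
    _  ∎
    where
    -- These are the least bounds that allow the shifts: moving the index of `g` by n with |n| ≤ N
    -- needs L + N ≤ 2P, and moving n by r + 1 with |r| ≤ P needs L + P + 1 ≤ N.
    P = suc (L ℕ.+ L)
    N = L ℕ.+ suc P
    supportʳ : ∀ n → Supported (λ m → f n * g m)
    supportʳ n m L≤m = trans (*-congˡ (suppᵍ m L≤m)) (zeroʳ _)
    supportˡ : ∀ d → Supported (λ n → f n * g (d ℤ.- n))
    supportˡ d n L≤n = trans (*-congʳ (suppᶠ n L≤n)) (zeroˡ _)
    L+N≡2P : L ℕ.+ N ≡ P ℕ.* 2
    L+N≡2P = double-bound L
      where
      double-bound : ∀ l → l ℕ.+ (l ℕ.+ suc (suc (l ℕ.+ l))) ≡ suc (l ℕ.+ l) ℕ.* 2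
      double-bound = ℕ-RingSolver.solve-∀
    shift≤2P : ∀ n → ∣ n ∣ ℕ.≤ N → L ℕ.+ ∣ ℤ.- n ∣ ℕ.≤ P ℕ.* 2
    shift≤2P n n≤N rewrite ℤₚ.∣-i∣≡∣i∣ n = ℕₚ.≤-trans (ℕₚ.+-monoʳ-≤ L n≤N) (ℕₚ.≤-reflexive L+N≡2P)
    L≤2P : L ℕ.≤ P ℕ.* 2
    L≤2P = ℕₚ.≤-trans (ℕₚ.m≤m+n L N) (ℕₚ.≤-reflexive L+N≡2P)

  module ThetaProduct (a u v : Carrier) (nilᵃ : Nil a) (nilᵘ : Nil u) (nilᵛ : Nil v) where

    mono : ℕ → ℕ → ℕ → Carrier
    mono i j k = a ^ i * u ^ j * v ^ k

    nil-mono : ∀ i j k → Nil (mono (suc i) j k)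
    nil-mono i j k = nil-* (v ^ k) (nil-* (u ^ j) (nil-* (a ^ i) nilᵃ))

    nil-monoᵘ : Nil (mono 0 1 0)
    nil-monoᵘ = nil-cong (solveˢ 1 (λ u → u := con 1 :* (u :* con 1) :* con 1) refl u) nilᵘ

    nil-monoᵛ : Nil (mono 0 0 1)
    nil-monoᵛ = nil-cong (solveˢ 1 (λ v → v := con 1 :* con 1 :* (v :* con 1)) refl v) nilᵛ

    mono-* : ∀ i j k i′ j′ k′ → mono i j k * mono i′ j′ k′ ≈ mono (i ℕ.+ i′) (j ℕ.+ j′) (k ℕ.+ k′)
    mono-* i j k i′ j′ k′ = begin
      mono i j k * mono i′ j′ k′
        ≈⟨ solveˢ 6 (λ p q r s t w → p :* q :* r :* (s :* t :* w) := p :* s :* (q :* t) :* (r :* w)) refl _ _ _ _ _ _ ⟩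
      a ^ i * a ^ i′ * (u ^ j * u ^ j′) * (v ^ k * v ^ k′)
        ≈⟨ *-cong (*-cong (^-homo-* a i i′) (^-homo-* u j j′)) (^-homo-* v k k′) ⟨
      mono (i ℕ.+ i′) (j ℕ.+ j′) (k ℕ.+ k′)  ∎

    mono-^ : ∀ i j k n → mono i j k ^ n ≈ mono (i ℕ.* n) (j ℕ.* n) (k ℕ.* n)
    mono-^ i j k n = begin
      (a ^ i * u ^ j * v ^ k) ^ n              ≈⟨ ^-distrib-* _ _ n ⟩
      (a ^ i * u ^ j) ^ n * (v ^ k) ^ n        ≈⟨ *-cong (^-distrib-* _ _ n) (^-assocʳ v k n) ⟩
      (a ^ i) ^ n * (u ^ j) ^ n * v ^ (k ℕ.* n)  ≈⟨ *-congʳ (*-cong (^-assocʳ a i n) (^-assocʳ u j n)) ⟩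
      mono (i ℕ.* n) (j ℕ.* n) (k ℕ.* n)       ∎

    mono-cong : ∀ {i j k i′ j′ k′} → i ≡ i′ → j ≡ j′ → k ≡ k′ → mono i j k ≈ mono i′ j′ k′
    mono-cong ≡.refl ≡.refl ≡.refl = refl

    thetaTerm-mono : ∀ i j k i′ j′ k′ n → thetaTerm (mono i j k) (mono i′ j′ k′) n ≈
      mono (i ℕ.* expᵃ n ℕ.+ i′ ℕ.* expᵇ n) (j ℕ.* expᵃ n ℕ.+ j′ ℕ.* expᵇ n) (k ℕ.* expᵃ n ℕ.+ k′ ℕ.* expᵇ n)
    thetaTerm-mono i j k i′ j′ k′ n = trans (*-cong (mono-^ i j k (expᵃ n)) (mono-^ i′ j′ k′ (expᵇ n)))
      (mono-* (i ℕ.* expᵃ n) (j ℕ.* expᵃ n) (k ℕ.* expᵃ n) (i′ ℕ.* expᵇ n) (j′ ℕ.* expᵇ n) (k′ ℕ.* expᵇ n))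

    quadratic : ℕ → ℕ → ℕ → ℕ → ℤ → ℤ → Exponent
    quadratic i i′ j j′ n m = i ⊛ triᵃ n ⊕ i′ ⊛ triᵇ n ⊕ (j ⊛ triᵃ m ⊕ j′ ⊛ triᵇ m)

    thetaTerms-mono : ∀ i j k i′ j′ k′ o p q o′ p′ q′ n m →
      thetaTerm (mono i j k) (mono i′ j′ k′) n * thetaTerm (mono o p q) (mono o′ p′ q′) m ≈
      mono ⟦ quadratic i i′ o o′ n m ⟧ ⟦ quadratic j j′ p p′ n m ⟧ ⟦ quadratic k k′ q q′ n m ⟧
    thetaTerms-mono i j k i′ j′ k′ o p q o′ p′ q′ n m =
      trans (*-cong (thetaTerm-mono i j k i′ j′ k′ n) (thetaTerm-mono o p q o′ p′ q′ m))
        (mono-* (linear i i′ n) (linear j j′ n) (linear k k′ n) (linear o o′ m) (linear p p′ m) (linear q q′ m))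
      where
      linear : ℕ → ℕ → ℤ → ℕ
      linear i i′ n = i ℕ.* expᵃ n ℕ.+ i′ ℕ.* expᵇ n

    -- With n = r + s and m = r - s the exponent of a is n² + m² = 2r² + 2s², and in the exponents
    -- of u and v the mixed terms r s cancel as well, so the summand factors. `eqᵃ`, `eqᵘ` and `eqᵛ`
    -- are the doubled exponents of both sides written out as polynomials.
    even-terms : ∀ r s →
      thetaTerm (mono 1 0 0) (mono 1 1 1) (s ℤ.+ r) * thetaTerm (mono 1 0 1) (mono 1 1 0) ((r ℤ.+ r) ℤ.- (s ℤ.+ r)) ≈
      thetaTerm (mono 2 0 1) (mono 2 2 1) r * thetaTerm (mono 2 1 0) (mono 2 1 2) s
    even-terms r s = begin
      _
        ≈⟨ thetaTerms-mono 1 0 0 1 1 1 1 0 1 1 1 0 n m ⟩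
      _
        ≈⟨ mono-cong (exponent-≡ (quadratic 1 1 1 1 n m) (quadratic 2 2 2 2 r s) (eqᵃ r s))
                     (exponent-≡ (quadratic 0 1 0 1 n m) (quadratic 0 2 1 1 r s) (eqᵘ r s))
                     (exponent-≡ (quadratic 0 1 1 0 n m) (quadratic 1 1 0 2 r s) (eqᵛ r s)) ⟩
      _
        ≈⟨ thetaTerms-mono 2 0 1 2 2 1 2 1 0 2 1 2 r s ⟨
      _  ∎
      where
      n m : ℤ
      n = s ℤ.+ r
      m = (r ℤ.+ r) ℤ.- (s ℤ.+ r)
      eqᵃ : ∀ r s →
            + 1 ℤ.* ((s ℤ.+ r) ℤ.* ((s ℤ.+ r) ℤ.+ + 1))
            ℤ.+ + 1 ℤ.* ((s ℤ.+ r) ℤ.* ((s ℤ.+ r) ℤ.- + 1))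
            ℤ.+ (+ 1 ℤ.* (((r ℤ.+ r) ℤ.- (s ℤ.+ r)) ℤ.* (((r ℤ.+ r) ℤ.- (s ℤ.+ r)) ℤ.+ + 1))
            ℤ.+ + 1 ℤ.* (((r ℤ.+ r) ℤ.- (s ℤ.+ r)) ℤ.* (((r ℤ.+ r) ℤ.- (s ℤ.+ r)) ℤ.- + 1)))
          ≡ + 2 ℤ.* (r ℤ.* (r ℤ.+ + 1))
            ℤ.+ + 2 ℤ.* (r ℤ.* (r ℤ.- + 1))
            ℤ.+ (+ 2 ℤ.* (s ℤ.* (s ℤ.+ + 1))
            ℤ.+ + 2 ℤ.* (s ℤ.* (s ℤ.- + 1)))
      eqᵃ = solve-∀
      eqᵘ : ∀ r s →
            + 0 ℤ.* ((s ℤ.+ r) ℤ.* ((s ℤ.+ r) ℤ.+ + 1))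
            ℤ.+ + 1 ℤ.* ((s ℤ.+ r) ℤ.* ((s ℤ.+ r) ℤ.- + 1))
            ℤ.+ (+ 0 ℤ.* (((r ℤ.+ r) ℤ.- (s ℤ.+ r)) ℤ.* (((r ℤ.+ r) ℤ.- (s ℤ.+ r)) ℤ.+ + 1))
            ℤ.+ + 1 ℤ.* (((r ℤ.+ r) ℤ.- (s ℤ.+ r)) ℤ.* (((r ℤ.+ r) ℤ.- (s ℤ.+ r)) ℤ.- + 1)))
          ≡ + 0 ℤ.* (r ℤ.* (r ℤ.+ + 1))
            ℤ.+ + 2 ℤ.* (r ℤ.* (r ℤ.- + 1))
            ℤ.+ (+ 1 ℤ.* (s ℤ.* (s ℤ.+ + 1))
            ℤ.+ + 1 ℤ.* (s ℤ.* (s ℤ.- + 1)))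
      eqᵘ = solve-∀
      eqᵛ : ∀ r s →
            + 0 ℤ.* ((s ℤ.+ r) ℤ.* ((s ℤ.+ r) ℤ.+ + 1))
            ℤ.+ + 1 ℤ.* ((s ℤ.+ r) ℤ.* ((s ℤ.+ r) ℤ.- + 1))
            ℤ.+ (+ 1 ℤ.* (((r ℤ.+ r) ℤ.- (s ℤ.+ r)) ℤ.* (((r ℤ.+ r) ℤ.- (s ℤ.+ r)) ℤ.+ + 1))
            ℤ.+ + 0 ℤ.* (((r ℤ.+ r) ℤ.- (s ℤ.+ r)) ℤ.* (((r ℤ.+ r) ℤ.- (s ℤ.+ r)) ℤ.- + 1)))
          ≡ + 1 ℤ.* (r ℤ.* (r ℤ.+ + 1))
            ℤ.+ + 1 ℤ.* (r ℤ.* (r ℤ.- + 1))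
            ℤ.+ (+ 0 ℤ.* (s ℤ.* (s ℤ.+ + 1))
            ℤ.+ + 2 ℤ.* (s ℤ.* (s ℤ.- + 1)))
      eqᵛ = solve-∀

    -- With n = r + s + 1 and m = r - s the exponent of a is 1 + 2r(r+1) + 2s(s+1); its constant
    -- term is the factor a in front.
    odd-terms : ∀ r s →
      thetaTerm (mono 1 0 0) (mono 1 1 1) (s ℤ.+ ℤ.suc r) * thetaTerm (mono 1 0 1) (mono 1 1 0) (ℤ.suc (r ℤ.+ r) ℤ.- (s ℤ.+ ℤ.suc r)) ≈
      mono 1 0 0 * (thetaTerm (mono 4 1 2) (mono 0 1 0) r * thetaTerm (mono 4 2 1) (mono 0 0 1) s)
    odd-terms r s = begin
      _
        ≈⟨ thetaTerms-mono 1 0 0 1 1 1 1 0 1 1 1 0 n m ⟩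
      _
        ≈⟨ mono-cong (exponent-≡ (quadratic 1 1 1 1 n m) (const 1 ⊕ quadratic 4 0 4 0 r s) (eqᵃ r s))
                     (exponent-≡ (quadratic 0 1 0 1 n m) (quadratic 1 1 2 0 r s) (eqᵘ r s))
                     (exponent-≡ (quadratic 0 1 1 0 n m) (quadratic 2 0 1 1 r s) (eqᵛ r s)) ⟩
      _
        ≈⟨ mono-* 1 0 0 ⟦ quadratic 4 0 4 0 r s ⟧ ⟦ quadratic 1 1 2 0 r s ⟧ ⟦ quadratic 2 0 1 1 r s ⟧ ⟨
      _
        ≈⟨ *-congˡ (thetaTerms-mono 4 1 2 0 1 0 4 2 1 0 0 1 r s) ⟨
      _  ∎
      where
      n m : ℤ
      n = s ℤ.+ ℤ.suc r
      m = ℤ.suc (r ℤ.+ r) ℤ.- (s ℤ.+ ℤ.suc r)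
      eqᵃ : ∀ r s →
            + 1 ℤ.* ((s ℤ.+ (+ 1 ℤ.+ r)) ℤ.* ((s ℤ.+ (+ 1 ℤ.+ r)) ℤ.+ + 1))
            ℤ.+ + 1 ℤ.* ((s ℤ.+ (+ 1 ℤ.+ r)) ℤ.* ((s ℤ.+ (+ 1 ℤ.+ r)) ℤ.- + 1))
            ℤ.+ (+ 1 ℤ.* (((+ 1 ℤ.+ (r ℤ.+ r)) ℤ.- (s ℤ.+ (+ 1 ℤ.+ r))) ℤ.* (((+ 1 ℤ.+ (r ℤ.+ r)) ℤ.- (s ℤ.+ (+ 1 ℤ.+ r))) ℤ.+ + 1))
            ℤ.+ + 1 ℤ.* (((+ 1 ℤ.+ (r ℤ.+ r)) ℤ.- (s ℤ.+ (+ 1 ℤ.+ r))) ℤ.* (((+ 1 ℤ.+ (r ℤ.+ r)) ℤ.- (s ℤ.+ (+ 1 ℤ.+ r))) ℤ.- + 1)))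
          ≡ + 2 ℤ.* + 1
            ℤ.+ (+ 4 ℤ.* (r ℤ.* (r ℤ.+ + 1))
            ℤ.+ + 0 ℤ.* (r ℤ.* (r ℤ.- + 1))
            ℤ.+ (+ 4 ℤ.* (s ℤ.* (s ℤ.+ + 1))
            ℤ.+ + 0 ℤ.* (s ℤ.* (s ℤ.- + 1))))
      eqᵃ = solve-∀
      eqᵘ : ∀ r s →
            + 0 ℤ.* ((s ℤ.+ (+ 1 ℤ.+ r)) ℤ.* ((s ℤ.+ (+ 1 ℤ.+ r)) ℤ.+ + 1))
            ℤ.+ + 1 ℤ.* ((s ℤ.+ (+ 1 ℤ.+ r)) ℤ.* ((s ℤ.+ (+ 1 ℤ.+ r)) ℤ.- + 1))
            ℤ.+ (+ 0 ℤ.* (((+ 1 ℤ.+ (r ℤ.+ r)) ℤ.- (s ℤ.+ (+ 1 ℤ.+ r))) ℤ.* (((+ 1 ℤ.+ (r ℤ.+ r)) ℤ.- (s ℤ.+ (+ 1 ℤ.+ r))) ℤ.+ + 1))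
            ℤ.+ + 1 ℤ.* (((+ 1 ℤ.+ (r ℤ.+ r)) ℤ.- (s ℤ.+ (+ 1 ℤ.+ r))) ℤ.* (((+ 1 ℤ.+ (r ℤ.+ r)) ℤ.- (s ℤ.+ (+ 1 ℤ.+ r))) ℤ.- + 1)))
          ≡ + 1 ℤ.* (r ℤ.* (r ℤ.+ + 1))
            ℤ.+ + 1 ℤ.* (r ℤ.* (r ℤ.- + 1))
            ℤ.+ (+ 2 ℤ.* (s ℤ.* (s ℤ.+ + 1))
            ℤ.+ + 0 ℤ.* (s ℤ.* (s ℤ.- + 1)))
      eqᵘ = solve-∀
      eqᵛ : ∀ r s →
            + 0 ℤ.* ((s ℤ.+ (+ 1 ℤ.+ r)) ℤ.* ((s ℤ.+ (+ 1 ℤ.+ r)) ℤ.+ + 1))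
            ℤ.+ + 1 ℤ.* ((s ℤ.+ (+ 1 ℤ.+ r)) ℤ.* ((s ℤ.+ (+ 1 ℤ.+ r)) ℤ.- + 1))
            ℤ.+ (+ 1 ℤ.* (((+ 1 ℤ.+ (r ℤ.+ r)) ℤ.- (s ℤ.+ (+ 1 ℤ.+ r))) ℤ.* (((+ 1 ℤ.+ (r ℤ.+ r)) ℤ.- (s ℤ.+ (+ 1 ℤ.+ r))) ℤ.+ + 1))
            ℤ.+ + 0 ℤ.* (((+ 1 ℤ.+ (r ℤ.+ r)) ℤ.- (s ℤ.+ (+ 1 ℤ.+ r))) ℤ.* (((+ 1 ℤ.+ (r ℤ.+ r)) ℤ.- (s ℤ.+ (+ 1 ℤ.+ r))) ℤ.- + 1)))
          ≡ + 2 ℤ.* (r ℤ.* (r ℤ.+ + 1))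
            ℤ.+ + 0 ℤ.* (r ℤ.* (r ℤ.- + 1))
            ℤ.+ (+ 1 ℤ.* (s ℤ.* (s ℤ.+ + 1))
            ℤ.+ + 1 ℤ.* (s ℤ.* (s ℤ.- + 1)))
      eqᵛ = solve-∀

    theta-product :
      theta (mono 1 0 0) (mono 1 1 1) * theta (mono 1 0 1) (mono 1 1 0) ≈
      theta (mono 2 0 1) (mono 2 2 1) * theta (mono 2 1 0) (mono 2 1 2) +
      mono 1 0 0 * (theta (mono 4 1 2) (mono 0 1 0) * theta (mono 4 2 1) (mono 0 0 1))
    theta-product = begin
      theta (mono 1 0 0) (mono 1 1 1) * theta (mono 1 0 1) (mono 1 1 0)
        ≈⟨ sumℤ-dissect (thetaTerm-supported (nil-mono 0 0 0) (nil-mono 0 1 1)) (thetaTerm-supported (nil-mono 0 0 1) (nil-mono 0 1 0)) ⟩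
      _
        ≈⟨ +-cong (sumℤ-cong P (λ r _ → sumℤ-cong N (λ s _ → even-terms r s)))
                  (sumℤ-cong P (λ r _ → trans (sumℤ-cong N (λ s _ → odd-terms r s)) (sym (sumℤ-*ˡ N _ _)))) ⟩
      _
        ≈⟨ +-cong (sumℤ-cauchy P N _ _) (trans (sym (sumℤ-*ˡ P _ _)) (*-congˡ (sumℤ-cauchy P N _ _))) ⟩
      _
        ≈⟨ +-cong (*-cong (truncateᴾ (thetaTerm-supported (nil-mono 1 0 1) (nil-mono 1 2 1)))
                          (truncateᴺ (thetaTerm-supported (nil-mono 1 1 0) (nil-mono 1 1 2))))
                  (*-congˡ (*-cong (truncateᴾ (thetaTerm-supported (nil-mono 3 1 2) nil-monoᵘ))
                                   (truncateᴺ (thetaTerm-supported (nil-mono 3 2 1) nil-monoᵛ)))) ⟩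
      _  ∎
      where
      P = suc (L ℕ.+ L)
      N = L ℕ.+ suc P
      truncateᴾ : ∀ {f} → Supported f → sumℤ P f ≈ sumℤ L f
      truncateᴾ supp = sumℤ-truncate supp (ℕₚ.m≤n⇒m≤1+n (ℕₚ.m≤m+n L L))
      truncateᴺ : ∀ {f} → Supported f → sumℤ N f ≈ sumℤ L f
      truncateᴺ supp = sumℤ-truncate supp (ℕₚ.m≤m+n L (suc P))

  -- Products over lists of part sizes

  prodOver : (ℕ → Carrier) → List ℕ → Carrier
  prodOver f []       = 1#
  prodOver f (r ∷ rs) = f r * prodOver f rs

  prodOver-++ : ∀ f rs ss → prodOver f (rs ++ ss) ≈ prodOver f rs * prodOver f ss
  prodOver-++ f []       ss = sym (*-identityˡ _)
  prodOver-++ f (r ∷ rs) ss = trans (*-congˡ (prodOver-++ f rs ss)) (sym (*-assoc _ _ _))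

  prodOver-↭ : ∀ f {rs ss} → rs ↭ ss → prodOver f rs ≈ prodOver f ss
  prodOver-↭ f Perm.refl          = refl
  prodOver-↭ f (Perm.prep r p)    = *-congˡ (prodOver-↭ f p)
  prodOver-↭ f (Perm.swap r s p)  = trans (*-congˡ (*-congˡ (prodOver-↭ f p)))
                                          (solveˢ 3 (λ a b c → a :* (b :* c) := b :* (a :* c)) refl _ _ _)
  prodOver-↭ f (Perm.trans p p′)  = trans (prodOver-↭ f p) (prodOver-↭ f p′)

  prodOver-1 : ∀ rs → prodOver (λ _ → 1#) rs ≈ 1#
  prodOver-1 []       = refl
  prodOver-1 (r ∷ rs) = trans (*-identityˡ _) (prodOver-1 rs)

  prodOver-* : ∀ f g rs → prodOver (λ r → f r * g r) rs ≈ prodOver f rs * prodOver g rs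
  prodOver-* f g []       = sym (*-identityˡ 1#)
  prodOver-* f g (r ∷ rs) = trans (*-congˡ (prodOver-* f g rs))
    (solveˢ 4 (λ a b c d → a :* b :* (c :* d) := a :* c :* (b :* d)) refl _ _ _ _)

  prodOver-map : ∀ {f g} (h : ℕ → ℕ) rs → (∀ r → f (h r) ≈ g r) → prodOver f (map h rs) ≈ prodOver g rs
  prodOver-map h []       eq = refl
  prodOver-map h (r ∷ rs) eq = *-cong (eq r) (prodOver-map h rs eq)

  poch-cong : ∀ {a b x y} → a ≈ b → x ≈ y → poch a x ≈ poch b y
  poch-cong a≈b x≈y = prod-cong L (λ k → +-congˡ (*-cong a≈b (^-congˡ k x≈y)))

  theta-cong : ∀ {a b a′ b′} → a ≈ a′ → b ≈ b′ → theta a b ≈ theta a′ b′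
  theta-cong a≈a′ b≈b′ = sumℤ-cong L (λ n _ → *-cong (^-congˡ (expᵃ n) a≈a′) (^-congˡ (expᵇ n) b≈b′))

  ^-double : ∀ x k → x ^ (k ℕ.* 2) ≈ (x * x) ^ k
  ^-double x zero    = refl
  ^-double x (suc k) = trans (sym (*-assoc x x _)) (*-congˡ (^-double x k))

  poch-parity : ∀ a {x} → Nil x → poch a x ≈ poch a (x * x) * poch (a * x) (x * x)
  poch-parity a {x} nilˣ = begin
    poch a x
      ≈⟨ prod-truncate (λ k L≤k → 1+0≈1 (trans (*-congˡ (nil-^ nilˣ L≤k)) (zeroʳ a))) (ℕₚ.m≤m*n L 2) ⟨
    prod (L ℕ.* 2) (λ k → 1# + a * x ^ k)
      ≈⟨ prod-parity L _ ⟩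
    prod L (λ k → 1# + a * x ^ (k ℕ.* 2)) * prod L (λ k → 1# + a * x ^ suc (k ℕ.* 2))
      ≈⟨ *-cong (prod-cong L (λ k → +-congˡ (*-congˡ (^-double x k))))
                (prod-cong L (λ k → +-congˡ (trans (sym (*-assoc a x _)) (*-congˡ (^-double x k))))) ⟩
    poch a (x * x) * poch (a * x) (x * x)  ∎

  poch-conjugate : ∀ a x → poch a x * poch (- a) x ≈ poch (- (a * a)) (x * x)
  poch-conjugate a x = trans (sym (prod-* L _ _)) (prod-cong L factor)
    where
    factor : ∀ k → (1# + a * x ^ k) * (1# + - a * x ^ k) ≈ 1# + - (a * a) * (x * x) ^ k
    factor k = begin
      (1# + a * x ^ k) * (1# + - a * x ^ k)
        ≈⟨ solveˢ 3 (λ a n p → (con 1 :+ a :* p) :* (con 1 :+ n :* p) := con 1 :+ ((n :+ a) :* p :+ a :* n :* (p :* p))) refl a (- a) (x ^ k) ⟩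
      1# + ((- a + a) * x ^ k + a * - a * (x ^ k * x ^ k))
        ≈⟨ +-congˡ (+-cong (trans (*-congʳ (-‿inverseˡ a)) (zeroˡ _)) (*-cong (sym (-‿distribʳ-* a a)) (sym (^-distrib-* x x k)))) ⟩
      1# + (0# + - (a * a) * (x * x) ^ k)
        ≈⟨ +-congˡ (+-identityˡ _) ⟩
      1# + - (a * a) * (x * x) ^ k  ∎

  -- Products and theta functions of powers of q

  module Residues (q : Carrier) (nilᑫ : Nil q) where

    nil-q^ : ∀ n {{_ : ℕ.NonZero n}} → Nil (q ^ n)
    nil-q^ (suc n) = nil-* (q ^ n) nilᑫ

    nil-neg : ∀ {y} → Nil y → Nil (- y)
    nil-neg {y} nilʸ = nil-cong (trans (sym (-‿distribʳ-* y 1#)) (-‿cong (*-identityʳ y))) (nil-* (- 1#) nilʸ)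

    -- (q^r; q^m)_∞
    A : ℕ → ℕ → Carrier
    A m r = poch (- (q ^ r)) (q ^ m)

    A-unit : ∀ m r {{_ : ℕ.NonZero m}} → Unit (A m (suc r))
    A-unit m r = prod-unit L (λ k → unit-cong (+-congˡ (sym (-‿distribˡ-* (q ^ suc r) ((q ^ m) ^ k)))) (unit-1-nil (nil-* _ (nil-q^ (suc r)))))
      where
      unit-cong : ∀ {y z} → z ≈ y → Unit y → Unit z
      unit-cong z≈y (y⁻¹ , eq) = y⁻¹ , trans (*-congʳ z≈y) eq

    A-parity : ∀ m r {{_ : ℕ.NonZero m}} → A m r ≈ A (m ℕ.+ m) r * A (m ℕ.+ m) (m ℕ.+ r)
    A-parity m r = trans (poch-parity _ (nil-q^ m)) (*-cong
      (poch-cong refl (sym (^-homo-* q m m)))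
      (poch-cong (trans (sym (-‿distribˡ-* _ _)) (-‿cong (trans (*-comm _ _) (sym (^-homo-* q m r))))) (sym (^-homo-* q m m))))

    poch-q-conjugate : ∀ m r → poch (q ^ r) (q ^ m) * A m r ≈ A (m ℕ.+ m) (r ℕ.+ r)
    poch-q-conjugate m r = trans (poch-conjugate _ _) (poch-cong (-‿cong (sym (^-homo-* q r r))) (sym (^-homo-* q m m)))

    -x*-y≈x*y : ∀ x y → - x * - y ≈ x * y
    -x*-y≈x*y x y = trans (sym (-‿distribˡ-* x (- y))) (trans (-‿cong (sym (-‿distribʳ-* x y))) (-‿involutive _))

    theta-neg : ∀ i j {{_ : ℕ.NonZero i}} {{_ : ℕ.NonZero j}} → let m = i ℕ.+ j in
                theta (- (q ^ i)) (- (q ^ j)) ≈ A m i * A m j * A m m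
    theta-neg i j = begin
      theta (- (q ^ i)) (- (q ^ j))
        ≈⟨ TripleProduct.triple-product (- (q ^ i)) (- (q ^ j)) (nil-neg (nil-q^ i)) (nil-neg (nil-q^ j)) ⟨
      poch (- (q ^ i)) x * poch (- (q ^ j)) x * poch (- x) x
        ≈⟨ *-cong (*-cong (poch-cong refl x≈qᵐ) (poch-cong refl x≈qᵐ)) (poch-cong (-‿cong x≈qᵐ) x≈qᵐ) ⟩
      A (i ℕ.+ j) i * A (i ℕ.+ j) j * A (i ℕ.+ j) (i ℕ.+ j)  ∎
      where
      x = - (q ^ i) * - (q ^ j)
      x≈qᵐ : x ≈ q ^ (i ℕ.+ j)
      x≈qᵐ = trans (-x*-y≈x*y _ _) (sym (^-homo-* q i j))

    -- The triple product yields factors 1 + q^e, which no partition product contains. The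
    -- multiplier on the left pairs each of them with its conjugate 1 - q^e.
    theta-pos : ∀ i j {{_ : ℕ.NonZero i}} {{_ : ℕ.NonZero j}} → let m = i ℕ.+ j in
                theta (q ^ i) (q ^ j) * (A m i * A m j) ≈ A (m ℕ.+ m) (i ℕ.+ i) * A (m ℕ.+ m) (j ℕ.+ j) * A m m
    theta-pos i j = begin
      theta (q ^ i) (q ^ j) * (A m i * A m j)
        ≈⟨ *-congʳ (TripleProduct.triple-product (q ^ i) (q ^ j) (nil-q^ i) (nil-q^ j)) ⟨
      poch (q ^ i) x * poch (q ^ j) x * poch (- x) x * (A m i * A m j)
        ≈⟨ *-congʳ (*-cong (*-cong (poch-cong refl x≈qᵐ) (poch-cong refl x≈qᵐ)) (poch-cong (-‿cong x≈qᵐ) x≈qᵐ)) ⟩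
      poch (q ^ i) (q ^ m) * poch (q ^ j) (q ^ m) * A m m * (A m i * A m j)
        ≈⟨ solveˢ 5 (λ p r s t u → p :* r :* s :* (t :* u) := p :* t :* (r :* u) :* s) refl _ _ _ _ _ ⟩
      poch (q ^ i) (q ^ m) * A m i * (poch (q ^ j) (q ^ m) * A m j) * A m m
        ≈⟨ *-congʳ (*-cong (poch-q-conjugate m i) (poch-q-conjugate m j)) ⟩
      A (m ℕ.+ m) (i ℕ.+ i) * A (m ℕ.+ m) (j ℕ.+ j) * A m m  ∎
      where
      m = i ℕ.+ j
      x = q ^ i * q ^ j
      x≈qᵐ : x ≈ q ^ m
      x≈qᵐ = sym (^-homo-* q i j)

    -- The sizes up to L p form L consecutive blocks of length p. Block number k contributes to
    -- every residue class r the factor 1 - q^(r + k p), and these are precisely the L factors of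
    -- `A p r`.
    prodOver-kinds : ∀ col p → (∀ s → col (p ℕ.+ s) ≡ col s) →
      prodOver (λ s → 1# - q ^ s) (kinds col (L ℕ.* p)) ≈ prodOver (A p) (kinds col p)
    prodOver-kinds col p periodic = blocks L
      where
      periods : ∀ N s → col (N ℕ.* p ℕ.+ s) ≡ col s
      periods zero    s = ≡.refl
      periods (suc N) s = ≡.trans (≡.cong col (ℕₚ.+-assoc p (N ℕ.* p) s)) (≡.trans (periodic _) (periods N s))
      blocks : ∀ N → prodOver (λ s → 1# - q ^ s) (kinds col (N ℕ.* p)) ≈
                     prodOver (λ r → prod N (λ k → 1# + - (q ^ r) * (q ^ p) ^ k)) (kinds col p)
      blocks zero    = sym (prodOver-1 (kinds col p))
      blocks (suc N) = begin
        prodOver F (kinds col (p ℕ.+ N ℕ.* p))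
          ≡⟨ ≡.cong (prodOver F) (≡.trans (≡.cong (kinds col) (ℕₚ.+-comm p (N ℕ.* p))) (≡.trans (kinds-+ col (N ℕ.* p) p)
              (≡.cong (λ ks → kinds col (N ℕ.* p) ++ map (N ℕ.* p ℕ.+_) ks) (kinds-cong (periods N) p)))) ⟩
        prodOver F (kinds col (N ℕ.* p) ++ map (N ℕ.* p ℕ.+_) (kinds col p))
          ≈⟨ prodOver-++ F (kinds col (N ℕ.* p)) _ ⟩
        prodOver F (kinds col (N ℕ.* p)) * prodOver F (map (N ℕ.* p ℕ.+_) (kinds col p))
          ≈⟨ *-cong (blocks N) (prodOver-map (N ℕ.* p ℕ.+_) (kinds col p) factor) ⟩
        prodOver (λ r → prod N (λ k → 1# + - (q ^ r) * (q ^ p) ^ k)) (kinds col p) * prodOver (λ r → 1# + - (q ^ r) * (q ^ p) ^ N) (kinds col p)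
          ≈⟨ prodOver-* _ _ (kinds col p) ⟨
        prodOver (λ r → prod (suc N) (λ k → 1# + - (q ^ r) * (q ^ p) ^ k)) (kinds col p)  ∎
        where
        F : ℕ → Carrier
        F s = 1# - q ^ s
        factor : ∀ r → 1# - q ^ (N ℕ.* p ℕ.+ r) ≈ 1# + - (q ^ r) * (q ^ p) ^ N
        factor r = +-congˡ (begin
          - (q ^ (N ℕ.* p ℕ.+ r))          ≈⟨ -‿cong (^-homo-* q (N ℕ.* p) r) ⟩
          - (q ^ (N ℕ.* p) * q ^ r)        ≈⟨ -‿cong (*-comm _ _) ⟩
          - (q ^ r * q ^ (N ℕ.* p))        ≈⟨ -‿distribˡ-* _ _ ⟩
          - (q ^ r) * q ^ (N ℕ.* p)        ≈⟨ *-congˡ (trans (reflexive (≡.cong (q ^_) (ℕₚ.*-comm N p))) (sym (^-assocʳ q p N))) ⟩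
          - (q ^ r) * (q ^ p) ^ N          ∎)

    -y^2k≈y^2k : ∀ y k → (- y) ^ (k ℕ.* 2) ≈ y ^ (k ℕ.* 2)
    -y^2k≈y^2k y k = trans (^-double (- y) k) (trans (^-congˡ k (-x*-y≈x*y y y)) (sym (^-double y k)))

    monomial : ∀ i j k l m n → (q ^ i) ^ l * (q ^ j) ^ m * (q ^ k) ^ n ≈ q ^ (i ℕ.* l ℕ.+ j ℕ.* m ℕ.+ k ℕ.* n)
    monomial i j k l m n = begin
      (q ^ i) ^ l * (q ^ j) ^ m * (q ^ k) ^ n
        ≈⟨ *-cong (*-cong (^-assocʳ q i l) (^-assocʳ q j m)) (^-assocʳ q k n) ⟩
      q ^ (i ℕ.* l) * q ^ (j ℕ.* m) * q ^ (k ℕ.* n)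
        ≈⟨ *-congʳ (^-homo-* q (i ℕ.* l) (j ℕ.* m)) ⟨
      q ^ (i ℕ.* l ℕ.+ j ℕ.* m) * q ^ (k ℕ.* n)
        ≈⟨ ^-homo-* q (i ℕ.* l ℕ.+ j ℕ.* m) (k ℕ.* n) ⟨
      q ^ (i ℕ.* l ℕ.+ j ℕ.* m ℕ.+ k ℕ.* n)  ∎

    -- This is `theta-product` at a = -q^i, u = q^j, v = q^k. Only first powers of a keep the sign:
    -- those in the arguments on its left and the factor in front of the odd part, which therefore
    -- changes sides as a sum.
    theta-product-q : ∀ i j k {{_ : ℕ.NonZero i}} {{_ : ℕ.NonZero j}} {{_ : ℕ.NonZero k}} →
      let Q l m n = q ^ (i ℕ.* l ℕ.+ j ℕ.* m ℕ.+ k ℕ.* n) in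
      theta (- Q 1 0 0) (- Q 1 1 1) * theta (- Q 1 0 1) (- Q 1 1 0) +
        Q 1 0 0 * (theta (Q 4 1 2) (Q 0 1 0) * theta (Q 4 2 1) (Q 0 0 1)) ≈
      theta (Q 2 0 1) (Q 2 2 1) * theta (Q 2 1 0) (Q 2 1 2)
    theta-product-q i j k = begin
      theta (- Q 1 0 0) (- Q 1 1 1) * theta (- Q 1 0 1) (- Q 1 1 0) + Q 1 0 0 * O
        ≈⟨ +-congʳ (*-cong (theta-cong (odd 0 0) (odd 1 1)) (theta-cong (odd 0 1) (odd 1 0))) ⟨
      theta (mono 1 0 0) (mono 1 1 1) * theta (mono 1 0 1) (mono 1 1 0) + Q 1 0 0 * O
        ≈⟨ +-congʳ theta-product ⟩
      theta (mono 2 0 1) (mono 2 2 1) * theta (mono 2 1 0) (mono 2 1 2) +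
      mono 1 0 0 * (theta (mono 4 1 2) (mono 0 1 0) * theta (mono 4 2 1) (mono 0 0 1)) + Q 1 0 0 * O
        ≈⟨ +-congʳ (+-cong (*-cong (theta-cong (even 1 0 1) (even 1 2 1)) (theta-cong (even 1 1 0) (even 1 1 2)))
             (*-cong (odd 0 0) (*-cong (theta-cong (even 2 1 2) (even 0 1 0)) (theta-cong (even 2 2 1) (even 0 0 1))))) ⟩
      E + - Q 1 0 0 * O + Q 1 0 0 * O
        ≈⟨ solveˢ 4 (λ e n p o → e :+ n :* o :+ p :* o := e :+ (n :+ p) :* o) refl E (- Q 1 0 0) (Q 1 0 0) O ⟩
      E + (- Q 1 0 0 + Q 1 0 0) * O
        ≈⟨ trans (+-congˡ (trans (*-congʳ (-‿inverseˡ _)) (zeroˡ O))) (+-identityʳ E) ⟩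
      E  ∎
      where
      Q : ℕ → ℕ → ℕ → Carrier
      Q l m n = q ^ (i ℕ.* l ℕ.+ j ℕ.* m ℕ.+ k ℕ.* n)
      open ThetaProduct (- (q ^ i)) (q ^ j) (q ^ k) (nil-neg (nil-q^ i)) (nil-q^ j) (nil-q^ k)
      O E : Carrier
      O = theta (Q 4 1 2) (Q 0 1 0) * theta (Q 4 2 1) (Q 0 0 1)
      E = theta (Q 2 0 1) (Q 2 2 1) * theta (Q 2 1 0) (Q 2 1 2)
      even : ∀ l m n → mono (l ℕ.* 2) m n ≈ Q (l ℕ.* 2) m n
      even l m n = trans (*-congʳ (*-congʳ (-y^2k≈y^2k (q ^ i) l))) (monomial i j k (l ℕ.* 2) m n)
      odd : ∀ m n → mono 1 m n ≈ - Q 1 m n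
      odd m n = begin
        - (q ^ i) * 1# * (q ^ j) ^ m * (q ^ k) ^ n    ≈⟨ *-congʳ (*-congʳ (-‿distribˡ-* (q ^ i) 1#)) ⟨
        - ((q ^ i) ^ 1) * (q ^ j) ^ m * (q ^ k) ^ n   ≈⟨ *-congʳ (-‿distribˡ-* _ _) ⟨
        - ((q ^ i) ^ 1 * (q ^ j) ^ m) * (q ^ k) ^ n   ≈⟨ -‿distribˡ-* _ _ ⟨
        - ((q ^ i) ^ 1 * (q ^ j) ^ m * (q ^ k) ^ n)   ≈⟨ -‿cong (monomial i j k 1 m n) ⟩
        - Q 1 m n                                     ∎

    -- The two dissections as identities between products modulo 60

    ⟪_⟫ : List ℕ → Carrier
    ⟪_⟫ = prodOver (A 60)

    ⟪⟫-++ : ∀ rs ss → ⟪ rs ++ ss ⟫ ≈ ⟪ rs ⟫ * ⟪ ss ⟫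
    ⟪⟫-++ = prodOver-++ (A 60)

    A-15 : ∀ r → A 15 r ≈ ⟪ split₁₅ r ⟫
    A-15 r = begin
      A 15 r
        ≈⟨ A-parity 15 r ⟩
      A 30 r * A 30 (15 ℕ.+ r)
        ≈⟨ *-cong (A-parity 30 r) (A-parity 30 (15 ℕ.+ r)) ⟩
      A 60 r * A 60 (30 ℕ.+ r) * (A 60 (15 ℕ.+ r) * A 60 (45 ℕ.+ r))
        ≈⟨ solveˢ 4 (λ a b c d → a :* b :* (c :* d) := a :* (b :* (c :* (d :* con 1)))) refl _ _ _ _ ⟩
      ⟪ split₁₅ r ⟫  ∎

    negTheta-product : ∀ i j {{_ : ℕ.NonZero i}} {{_ : ℕ.NonZero j}} → i ℕ.+ j ≡ 15 →
                       theta (- (q ^ i)) (- (q ^ j)) ≈ ⟪ negTheta i j ⟫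
    negTheta-product i j i+j≡15 = begin
      theta (- (q ^ i)) (- (q ^ j))
        ≈⟨ theta-neg i j ⟩
      A (i ℕ.+ j) i * A (i ℕ.+ j) j * A (i ℕ.+ j) (i ℕ.+ j)
        ≡⟨ ≡.cong (λ m → A m i * A m j * A m m) i+j≡15 ⟩
      A 15 i * A 15 j * A 15 15
        ≈⟨ *-cong (*-cong (A-15 i) (A-15 j)) (A-15 15) ⟩
      ⟪ split₁₅ i ⟫ * ⟪ split₁₅ j ⟫ * ⟪ split₁₅ 15 ⟫
        ≈⟨ *-assoc _ _ _ ⟩
      ⟪ split₁₅ i ⟫ * (⟪ split₁₅ j ⟫ * ⟪ split₁₅ 15 ⟫)
        ≈⟨ trans (⟪⟫-++ (split₁₅ i) (split₁₅ j ++ split₁₅ 15)) (*-congˡ (⟪⟫-++ (split₁₅ j) (split₁₅ 15))) ⟨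
      ⟪ negTheta i j ⟫  ∎

    posTheta-product : ∀ i j {{_ : ℕ.NonZero i}} {{_ : ℕ.NonZero j}} → i ℕ.+ j ≡ 30 →
                       theta (q ^ i) (q ^ j) * ⟪ posThetaDen i j ⟫ ≈ ⟪ posThetaNum i j ⟫
    posTheta-product i j i+j≡30 = begin
      theta (q ^ i) (q ^ j) * ⟪ posThetaDen i j ⟫
        ≈⟨ *-congˡ (solveˢ 4 (λ a b c d → a :* (b :* (c :* (d :* con 1))) := a :* b :* (c :* d)) refl _ _ _ _) ⟩
      theta (q ^ i) (q ^ j) * (A 60 i * A 60 (30 ℕ.+ i) * (A 60 j * A 60 (30 ℕ.+ j)))
        ≈⟨ *-congˡ (*-cong (A-parity 30 i) (A-parity 30 j)) ⟨
      theta (q ^ i) (q ^ j) * (A 30 i * A 30 j)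
        ≈⟨ ≡.subst (λ m → theta (q ^ i) (q ^ j) * (A m i * A m j) ≈ A (m ℕ.+ m) (i ℕ.+ i) * A (m ℕ.+ m) (j ℕ.+ j) * A m m)
             i+j≡30 (theta-pos i j) ⟩
      A 60 (i ℕ.+ i) * A 60 (j ℕ.+ j) * A 30 30
        ≈⟨ *-congˡ (A-parity 30 30) ⟩
      A 60 (i ℕ.+ i) * A 60 (j ℕ.+ j) * (A 60 30 * A 60 60)
        ≈⟨ solveˢ 4 (λ a b c d → a :* b :* (c :* d) := a :* (b :* (c :* (d :* con 1)))) refl _ _ _ _ ⟩
      ⟪ posThetaNum i j ⟫  ∎

    ++-product : ∀ {y y′} rs ss rs′ ss′ → y * ⟪ rs ⟫ ≈ ⟪ ss ⟫ → y′ * ⟪ rs′ ⟫ ≈ ⟪ ss′ ⟫ →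
                 (y * y′) * ⟪ rs ++ rs′ ⟫ ≈ ⟪ ss ++ ss′ ⟫
    ++-product {y} {y′} rs ss rs′ ss′ eq eq′ = begin
      (y * y′) * ⟪ rs ++ rs′ ⟫            ≈⟨ *-congˡ (⟪⟫-++ rs rs′) ⟩
      (y * y′) * (⟪ rs ⟫ * ⟪ rs′ ⟫)       ≈⟨ solveˢ 4 (λ a b c d → a :* b :* (c :* d) := a :* c :* (b :* d)) refl _ _ _ _ ⟩
      (y * ⟪ rs ⟫) * (y′ * ⟪ rs′ ⟫)       ≈⟨ *-cong eq eq′ ⟩
      ⟪ ss ⟫ * ⟪ ss′ ⟫                    ≈⟨ ⟪⟫-++ ss ss′ ⟨
      ⟪ ss ++ ss′ ⟫                       ∎

    -- The theta identity is multiplied by both denominators; each theta product absorbs its own,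
    -- and the other one stays as a factor.
    clear-denominators : ∀ {T y O E} ts od on ed en →
      T ≈ ⟪ ts ⟫ → O * ⟪ od ⟫ ≈ ⟪ on ⟫ → E * ⟪ ed ⟫ ≈ ⟪ en ⟫ → T + y * O ≈ E →
      ⟪ ts ++ (ed ++ od) ⟫ + y * ⟪ on ++ ed ⟫ ≈ ⟪ en ++ od ⟫
    clear-denominators {T} {y} {O} {E} ts od on ed en T≈ts O≈on E≈en T+yO≈E = begin
      ⟪ ts ++ (ed ++ od) ⟫ + y * ⟪ on ++ ed ⟫
        ≈⟨ +-cong (trans (⟪⟫-++ ts _) (*-congˡ (⟪⟫-++ ed od))) (*-congˡ (⟪⟫-++ on ed)) ⟩
      ⟪ ts ⟫ * (⟪ ed ⟫ * ⟪ od ⟫) + y * (⟪ on ⟫ * ⟪ ed ⟫)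
        ≈⟨ +-cong (*-congʳ T≈ts) (*-congˡ (*-congʳ O≈on)) ⟨
      T * (⟪ ed ⟫ * ⟪ od ⟫) + y * ((O * ⟪ od ⟫) * ⟪ ed ⟫)
        ≈⟨ solveˢ 5 (λ t e d y o → t :* (e :* d) :+ y :* (o :* d :* e) := (t :+ y :* o) :* e :* d) refl _ _ _ _ _ ⟩
      (T + y * O) * ⟪ ed ⟫ * ⟪ od ⟫
        ≈⟨ *-congʳ (trans (*-congʳ T+yO≈E) E≈en) ⟩
      ⟪ en ⟫ * ⟪ od ⟫
        ≈⟨ ⟪⟫-++ en od ⟨
      ⟪ en ++ od ⟫  ∎

    dissection : ⟪ negNum ⟫ + q ^ 2 * ⟪ oddNum ⟫ ≈ ⟪ evenNum ⟫
    dissection = clear-denominators (negTheta 2 13 ++ negTheta 7 8)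
      oddDen (posThetaNum 24 6 ++ posThetaNum 25 5) evenDen (posThetaNum 9 21 ++ posThetaNum 10 20)
      (trans (*-cong (negTheta-product 2 13 ≡.refl) (negTheta-product 7 8 ≡.refl)) (sym (⟪⟫-++ (negTheta 2 13) (negTheta 7 8))))
      (++-product (posThetaDen 24 6) (posThetaNum 24 6) (posThetaDen 25 5) (posThetaNum 25 5)
        (posTheta-product 24 6 ≡.refl) (posTheta-product 25 5 ≡.refl))
      (++-product (posThetaDen 9 21) (posThetaNum 9 21) (posThetaDen 10 20) (posThetaNum 10 20)
        (posTheta-product 9 21 ≡.refl) (posTheta-product 10 20 ≡.refl))
      (theta-product-q 2 6 5)

    dissection′ : ⟪ negNum′ ⟫ + q ^ 1 * ⟪ oddNum′ ⟫ ≈ ⟪ evenNum′ ⟫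
    dissection′ = clear-denominators (negTheta 1 14 ++ negTheta 4 11)
      oddDen′ (posThetaNum 20 10 ++ posThetaNum 27 3) evenDen′ (posThetaNum 5 25 ++ posThetaNum 12 18)
      (trans (*-cong (negTheta-product 1 14 ≡.refl) (negTheta-product 4 11 ≡.refl)) (sym (⟪⟫-++ (negTheta 1 14) (negTheta 4 11))))
      (++-product (posThetaDen 20 10) (posThetaNum 20 10) (posThetaDen 27 3) (posThetaNum 27 3)
        (posTheta-product 20 10 ≡.refl) (posTheta-product 27 3 ≡.refl))
      (++-product (posThetaDen 5 25) (posThetaNum 5 25) (posThetaDen 12 18) (posThetaNum 12 18)
        (posTheta-product 5 25 ≡.refl) (posTheta-product 12 18 ≡.refl))
      (theta-product-q 1 10 3)

    clear-partitions : ∀ {F rs} ks rest → ⟪ ks ⟫ * F ≈ 1# → rs ↭ ks ++ rest → ⟪ rs ⟫ * F ≈ ⟪ rest ⟫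
    clear-partitions {F} {rs} ks rest ks*F≈1 rs↭ks++rest = begin
      ⟪ rs ⟫ * F                ≈⟨ *-congʳ (trans (prodOver-↭ (A 60) rs↭ks++rest) (⟪⟫-++ ks rest)) ⟩
      ⟪ ks ⟫ * ⟪ rest ⟫ * F     ≈⟨ solveˢ 3 (λ k r f → k :* r :* f := k :* f :* r) refl _ _ _ ⟩
      ⟪ ks ⟫ * F * ⟪ rest ⟫     ≈⟨ trans (*-congʳ ks*F≈1) (*-identityˡ _) ⟩
      ⟪ rest ⟫                  ∎

    ⟪⟫-unit : ∀ rs → Unit ⟪ map suc rs ⟫
    ⟪⟫-unit []       = 1# , *-identityˡ 1#
    ⟪⟫-unit (r ∷ rs) = unit-* (A-unit 60 r) (⟪⟫-unit rs)

    -- Multiplied by `clearing`, both sides become `negNum`·`common` + q²·`oddNum`·`common` +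
    -- q·`oddNum′`·`common′`: the dissections expand the terms of F₇ and F₉, and `negNum↭negNum′`
    -- matches the leading products.
    partition-identity : ∀ {F₇ F₈ F₉ F₁₀} →
      ⟪ kinds col₇ 60 ⟫ * F₇ ≈ 1# → ⟪ kinds col₈ 60 ⟫ * F₈ ≈ 1# →
      ⟪ kinds col₉ 60 ⟫ * F₉ ≈ 1# → ⟪ kinds col₁₀ 60 ⟫ * F₁₀ ≈ 1# →
      F₇ + q ^ 1 * F₈ ≈ F₉ + q ^ 2 * F₁₀
    -- `clearing` is a closed list of positive numbers, so applying `ℕ.pred` and then `suc` to its
    -- entries evaluates to the list itself.
    partition-identity {F₇} {F₈} {F₉} {F₁₀} eq₇ eq₈ eq₉ eq₁₀ = unit-cancel (⟪⟫-unit (map ℕ.pred clearing)) (begin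
      ⟪ clearing ⟫ * (F₇ + q ^ 1 * F₈)
        ≈⟨ solveˢ 4 (λ c f y g → c :* (f :+ y :* g) := c :* f :+ y :* (c :* g)) refl _ _ _ _ ⟩
      ⟪ clearing ⟫ * F₇ + q ^ 1 * (⟪ clearing ⟫ * F₈)
        ≈⟨ +-cong (clear-partitions (kinds col₇ 60) (evenNum ++ common) eq₇ Perm.refl)
                  (*-congˡ (clear-partitions (kinds col₈ 60) (oddNum′ ++ common′) eq₈ clearing↭₈)) ⟩
      ⟪ evenNum ++ common ⟫ + q ^ 1 * ⟪ oddNum′ ++ common′ ⟫
        ≈⟨ +-cong (trans (⟪⟫-++ evenNum common) (*-congʳ (sym dissection))) (*-congˡ (⟪⟫-++ oddNum′ common′)) ⟩
      (⟪ negNum ⟫ + q ^ 2 * ⟪ oddNum ⟫) * ⟪ common ⟫ + q ^ 1 * (⟪ oddNum′ ⟫ * ⟪ common′ ⟫)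
        ≈⟨ solveˢ 7 (λ l y o c z o′ c′ → (l :+ y :* o) :* c :+ z :* (o′ :* c′) := l :* c :+ (y :* (o :* c) :+ z :* o′ :* c′)) refl _ _ _ _ _ _ _ ⟩
      ⟪ negNum ⟫ * ⟪ common ⟫ + (q ^ 2 * (⟪ oddNum ⟫ * ⟪ common ⟫) + q ^ 1 * ⟪ oddNum′ ⟫ * ⟪ common′ ⟫)
        ≈⟨ +-congʳ (trans (sym (⟪⟫-++ negNum common)) (trans (prodOver-↭ (A 60) negNum↭negNum′) (⟪⟫-++ negNum′ common′))) ⟩
      ⟪ negNum′ ⟫ * ⟪ common′ ⟫ + (q ^ 2 * (⟪ oddNum ⟫ * ⟪ common ⟫) + q ^ 1 * ⟪ oddNum′ ⟫ * ⟪ common′ ⟫)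
        ≈⟨ solveˢ 7 (λ l′ y o c z o′ c′ → l′ :* c′ :+ (y :* (o :* c) :+ z :* o′ :* c′) := (l′ :+ z :* o′) :* c′ :+ y :* (o :* c)) refl _ _ _ _ _ _ _ ⟩
      (⟪ negNum′ ⟫ + q ^ 1 * ⟪ oddNum′ ⟫) * ⟪ common′ ⟫ + q ^ 2 * (⟪ oddNum ⟫ * ⟪ common ⟫)
        ≈⟨ +-cong (trans (⟪⟫-++ evenNum′ common′) (*-congʳ (sym dissection′))) (*-congˡ (⟪⟫-++ oddNum common)) ⟨
      ⟪ evenNum′ ++ common′ ⟫ + q ^ 2 * ⟪ oddNum ++ common ⟫
        ≈⟨ +-cong (clear-partitions (kinds col₉ 60) (evenNum′ ++ common′) eq₉ clearing↭₉)
                  (*-congˡ (clear-partitions (kinds col₁₀ 60) (oddNum ++ common) eq₁₀ clearing↭₁₀)) ⟨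
      ⟪ clearing ⟫ * F₉ + q ^ 2 * (⟪ clearing ⟫ * F₁₀)
        ≈⟨ solveˢ 4 (λ c f y g → c :* (f :+ y :* g) := c :* f :+ y :* (c :* g)) refl _ _ _ _ ⟨
      ⟪ clearing ⟫ * (F₉ + q ^ 2 * F₁₀)  ∎)

-- Generating functions

module _ (s : ℕ) (ks : List ℕ) where

  private
    summand : ℕ → ℕ → ℕ
    summand n j = if j ℕ.* s ℕ.≤ᵇ n then countKinds ks (n ℕ.∸ j ℕ.* s) else 0

    summand≡0 : ∀ {n j} → n ℕ.< j ℕ.* s → summand n j ≡ 0
    summand≡0 {n} {j} n<js with j ℕ.* s ℕ.≤ᵇ n in eq
    ... | true  = contradiction (ℕₚ.≤ᵇ⇒≤ (j ℕ.* s) n (≡.subst T (≡.sym eq) _)) (ℕₚ.<⇒≱ n<js)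
    ... | false = ≡.refl

    summand-shift : ∀ n j → summand (s ℕ.+ n) (suc j) ≡ summand n j
    summand-shift n j = ≡.cong₂ (λ b m → if b then countKinds ks m else 0)
      (does-⇔ (mk⇔ (ℕₚ.+-cancelˡ-≤ s _ _) (ℕₚ.+-monoʳ-≤ s)) (s ℕ.+ j ℕ.* s ℕₚ.≤? s ℕ.+ n) (j ℕ.* s ℕₚ.≤? n))
      (ℕₚ.[m+n]∸[m+o]≡n∸o s n (j ℕ.* s))

    sum-cong : ∀ {f g : ℕ → ℕ} n → (∀ j → f j ≡ g j) → sum (applyUpTo f n) ≡ sum (applyUpTo g n)
    sum-cong zero    eq = ≡.refl
    sum-cong (suc n) eq = ≡.cong₂ ℕ._+_ (eq 0) (sum-cong n (eq ∘ suc))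

    sum-0 : ∀ {f : ℕ → ℕ} n → (∀ j → f j ≡ 0) → sum (applyUpTo f n) ≡ 0
    sum-0 zero    f≡0 = ≡.refl
    sum-0 (suc n) f≡0 = ≡.cong₂ ℕ._+_ (f≡0 0) (sum-0 n (f≡0 ∘ suc))

    sum-extend : ∀ {f : ℕ → ℕ} n d → (∀ j → n ℕ.≤ j → f j ≡ 0) → sum (applyUpTo f (n ℕ.+ d)) ≡ sum (applyUpTo f n)
    sum-extend {f} zero    d f≡0 = sum-0 d (λ j → f≡0 j ℕ.z≤n)
    sum-extend {f} (suc n) d f≡0 = ≡.cong (f 0 ℕ.+_) (sum-extend n d (λ j n≤j → f≡0 (suc j) (ℕ.s≤s n≤j)))

    countKinds-∷ : ∀ n → countKinds (s ∷ ks) n ≡ sum (applyUpTo (summand n) (suc n))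
    countKinds-∷ n = ≡.cong sum (Listₚ.map-upTo (summand n) (suc n))

  countKinds-< : ∀ {n} → n ℕ.< s → countKinds (s ∷ ks) n ≡ countKinds ks n
  countKinds-< {n} n<s = ≡.trans (countKinds-∷ n) (≡.trans
    (≡.cong (countKinds ks n ℕ.+_) (sum-0 n (λ j → summand≡0 {n} {suc j} (ℕₚ.<-≤-trans n<s (ℕₚ.m≤m+n s (j ℕ.* s))))))
    (ℕₚ.+-identityʳ _))

  -- A partition either has no copy of `s` or arises by adding one copy. Multiplicities are bounded
  -- by the partitioned number, so passing from `s + n` to `n` also shortens the range; the lost
  -- summands are 0, since j > n and s ≥ 1 give j s > n.
  countKinds-+ : 0 ℕ.< s → ∀ n → countKinds (s ∷ ks) (s ℕ.+ n) ≡ countKinds ks (s ℕ.+ n) ℕ.+ countKinds (s ∷ ks) n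
  countKinds-+ 0<s n = ≡.trans (countKinds-∷ (s ℕ.+ n)) (≡.cong (countKinds ks (s ℕ.+ n) ℕ.+_) (begin
    sum (applyUpTo (summand (s ℕ.+ n) ∘ suc) (s ℕ.+ n))   ≡⟨ sum-cong (s ℕ.+ n) (summand-shift n) ⟩
    sum (applyUpTo (summand n) (s ℕ.+ n))                 ≡⟨ ≡.cong (sum ∘ applyUpTo (summand n)) s+n≡1+n+[s-1] ⟩
    sum (applyUpTo (summand n) (suc n ℕ.+ ℕ.pred s))      ≡⟨ sum-extend (suc n) (ℕ.pred s) beyond ⟩
    sum (applyUpTo (summand n) (suc n))                   ≡⟨ countKinds-∷ n ⟨
    countKinds (s ∷ ks) n                                 ∎))
    where
    open ≡.≡-Reasoning
    instance _ = ℕ.>-nonZero 0<s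
    s+n≡1+n+[s-1] : s ℕ.+ n ≡ suc n ℕ.+ ℕ.pred s
    s+n≡1+n+[s-1] = ≡.trans (ℕₚ.+-comm s n) (≡.trans (≡.cong (n ℕ.+_) (≡.sym (ℕₚ.suc-pred s))) (ℕₚ.+-suc n _))
    beyond : ∀ j → suc n ℕ.≤ j → summand n j ≡ 0
    beyond j n<j = summand≡0 {n} {j} (ℕₚ.<-≤-trans n<j (ℕₚ.m≤m*n j s))

countKinds-++ : ∀ ks {ls} n → All (n ℕ.<_) ls → countKinds (ks ++ ls) n ≡ countKinds ks n
countKinds-++ [] n [] = ≡.refl
countKinds-++ [] {l ∷ ls} n (n<l ∷ n<ls) = ≡.trans (countKinds-< l ls n<l) (countKinds-++ [] n n<ls)
countKinds-++ (k ∷ ks) {ls} n n<ls = ≡.cong sum (Listₚ.map-cong summands (upTo (suc n)))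
  where
  summands : ∀ j → (if j ℕ.* k ℕ.≤ᵇ n then countKinds (ks ++ ls) (n ℕ.∸ j ℕ.* k) else 0) ≡
                   (if j ℕ.* k ℕ.≤ᵇ n then countKinds ks (n ℕ.∸ j ℕ.* k) else 0)
  summands j = ≡.cong (λ c → if j ℕ.* k ℕ.≤ᵇ n then c else 0)
    (countKinds-++ ks (n ℕ.∸ j ℕ.* k) (All.map (ℕₚ.≤-<-trans (ℕₚ.m∸n≤m n (j ℕ.* k))) n<ls))

-- `colPart` takes a new list of kinds for each `n`. Kinds larger than `n` do not affect the count,
-- so one long list serves all coefficients and the values of `colPart` come from a single product.
colPart-truncate : ∀ col {n N} → n ℕ.≤ N → countKinds (kinds col N) n ≡ colPart col n
colPart-truncate col {n} {N} n≤N = begin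
  countKinds (kinds col N) n
    ≡⟨ ≡.cong (λ N → countKinds (kinds col N) n) (ℕₚ.m+[n∸m]≡n n≤N) ⟨
  countKinds (kinds col (n ℕ.+ (N ℕ.∸ n))) n
    ≡⟨ ≡.cong (λ ks → countKinds ks n) (kinds-+ col n (N ℕ.∸ n)) ⟩
  countKinds (kinds col n ++ map (n ℕ.+_) (kinds (λ s → col (n ℕ.+ s)) (N ℕ.∸ n))) n
    ≡⟨ countKinds-++ (kinds col n) n (Allₚ.map⁺ (All.map (λ 0<s → ℕₚ.m<m+n n 0<s) (kinds-positive (λ s → col (n ℕ.+ s)) (N ℕ.∸ n)))) ⟩
  colPart col n  ∎
  where open ≡.≡-Reasoning

colors-periodic : ∀ allowed doubled s → colors allowed doubled (60 ℕ.+ s) ≡ colors allowed doubled s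
colors-periodic allowed doubled s = ≡.cong
  (λ r → if memᵇ r (pm60 allowed) then (if memᵇ r (pm60 doubled) then 2 else 1) else 0)
  (≡.trans (≡.cong (ℕ._% 60) (ℕₚ.+-comm 60 s)) (ℕ-DivMod.[m+n]%n≡m%n s 60))

-- Formal power series over the integers

Series : Set
Series = ℕ → ℤ

module _ where
  open import Data.Integer.Base using (_+_; _*_)

  infixl 7 _⋆_

  -- The Cauchy product, by recursion on the degree through f = f(0) + q (f ∘ suc).
  _⋆_ : Series → Series → Series
  (f ⋆ g) zero    = f 0 * g 0
  (f ⋆ g) (suc n) = f 0 * g (suc n) + ((f ∘ suc) ⋆ g) n

  one : Series
  one zero    = + 1
  one (suc _) = + 0

  -- Coefficient n involves only degrees up to n; the bounded hypotheses make the product respect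
  -- equality below a given degree.
  ⋆-cong : ∀ n {f f′ g g′} → (∀ i → i ℕ.≤ n → f i ≡ f′ i) → (∀ i → i ℕ.≤ n → g i ≡ g′ i) → (f ⋆ g) n ≡ (f′ ⋆ g′) n
  ⋆-cong zero    f≡f′ g≡g′ = ≡.cong₂ _*_ (f≡f′ 0 ℕ.z≤n) (g≡g′ 0 ℕ.z≤n)
  ⋆-cong (suc n) f≡f′ g≡g′ = ≡.cong₂ _+_ (≡.cong₂ _*_ (f≡f′ 0 ℕ.z≤n) (g≡g′ (suc n) ℕₚ.≤-refl))
    (⋆-cong n (λ i i≤n → f≡f′ (suc i) (ℕ.s≤s i≤n)) (λ i i≤n → g≡g′ i (ℕₚ.m≤n⇒m≤1+n i≤n)))

  ⋆-zeroˡ : ∀ n g → ((λ _ → + 0) ⋆ g) n ≡ + 0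
  ⋆-zeroˡ zero    g = ≡.refl
  ⋆-zeroˡ (suc n) g = ≡.trans (ℤₚ.+-identityˡ _) (⋆-zeroˡ n g)

  ⋆-identityˡ : ∀ n g → (one ⋆ g) n ≡ g n
  ⋆-identityˡ zero    g = ℤₚ.*-identityˡ (g 0)
  ⋆-identityˡ (suc n) g = ≡.trans (≡.cong₂ _+_ (ℤₚ.*-identityˡ (g (suc n))) (⋆-zeroˡ n g)) (ℤₚ.+-identityʳ _)

  ⋆-scalar : ∀ n c f g → ((λ i → c * f i) ⋆ g) n ≡ c * (f ⋆ g) n
  ⋆-scalar zero    c f g = ℤₚ.*-assoc c (f 0) (g 0)
  ⋆-scalar (suc n) c f g = ≡.trans (≡.cong₂ _+_ (ℤₚ.*-assoc c (f 0) _) (⋆-scalar n c (f ∘ suc) g))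
                                   (≡.sym (ℤₚ.*-distribˡ-+ c _ _))

  ⋆-distribʳ : ∀ n f g h → ((λ i → f i + g i) ⋆ h) n ≡ (f ⋆ h) n + (g ⋆ h) n
  ⋆-distribʳ zero    f g h = ℤₚ.*-distribʳ-+ (h 0) (f 0) (g 0)
  ⋆-distribʳ (suc n) f g h = ≡.trans
    (≡.cong (λ y → (f 0 + g 0) * h (suc n) + y) (⋆-distribʳ n (f ∘ suc) (g ∘ suc) h))
    (regroup (f 0) (g 0) (h (suc n)) _ _)
    where
    regroup : ∀ a b c d e → (a + b) * c + (d + e) ≡ (a * c + d) + (b * c + e)
    regroup = solve-∀

  ⋆-sucʳ : ∀ n f g → (f ⋆ g) (suc n) ≡ (f ⋆ (g ∘ suc)) n + f (suc n) * g 0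
  ⋆-sucʳ zero    f g = ≡.refl
  ⋆-sucʳ (suc n) f g = ≡.trans (≡.cong (λ y → f 0 * g (suc (suc n)) + y) (⋆-sucʳ n (f ∘ suc) g)) (≡.sym (ℤₚ.+-assoc (f 0 * g (suc (suc n))) _ _))

  ⋆-comm : ∀ n f g → (f ⋆ g) n ≡ (g ⋆ f) n
  ⋆-comm zero    f g = ℤₚ.*-comm (f 0) (g 0)
  ⋆-comm (suc n) f g = ≡.trans (ℤₚ.+-comm _ (((f ∘ suc) ⋆ g) n))
    (≡.trans (≡.cong₂ _+_ (⋆-comm n (f ∘ suc) g) (ℤₚ.*-comm (f 0) _)) (≡.sym (⋆-sucʳ n g f)))

  ⋆-assoc : ∀ n f g h → ((f ⋆ g) ⋆ h) n ≡ (f ⋆ (g ⋆ h)) n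
  ⋆-assoc zero    f g h = ℤₚ.*-assoc (f 0) (g 0) (h 0)
  ⋆-assoc (suc n) f g h = begin
    f 0 * g 0 * h (suc n) + ((λ i → f 0 * g (suc i) + ((f ∘ suc) ⋆ g) i) ⋆ h) n
      ≡⟨ ≡.cong (λ y → f 0 * g 0 * h (suc n) + y) (⋆-distribʳ n (λ i → f 0 * g (suc i)) ((f ∘ suc) ⋆ g) h) ⟩
    f 0 * g 0 * h (suc n) + (((λ i → f 0 * g (suc i)) ⋆ h) n + (((f ∘ suc) ⋆ g) ⋆ h) n)
      ≡⟨ ≡.cong₂ (λ y z → f 0 * g 0 * h (suc n) + (y + z)) (⋆-scalar n (f 0) (g ∘ suc) h) (⋆-assoc n (f ∘ suc) g h) ⟩
    f 0 * g 0 * h (suc n) + (f 0 * ((g ∘ suc) ⋆ h) n + ((f ∘ suc) ⋆ (g ⋆ h)) n)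
      ≡⟨ regroup (f 0) (g 0) (h (suc n)) _ _ ⟩
    f 0 * (g 0 * h (suc n) + ((g ∘ suc) ⋆ h) n) + ((f ∘ suc) ⋆ (g ⋆ h)) n  ∎
    where
    open ≡.≡-Reasoning
    regroup : ∀ a b c d e → a * b * c + (a * d + e) ≡ a * (b * c + d) + e
    regroup = solve-∀

-- ℤ[[q]] / (q^L), represented by power series that are compared below degree L only.
truncatedSeries : ℕ → CommutativeRing _ _
truncatedSeries L = record
  { Carrier = Series
  ; _≈_     = λ f g → ∀ n → n ℕ.< L → f n ≡ g n
  ; _+_     = λ f g n → f n ℤ.+ g n
  ; _*_     = _⋆_
  ; -_      = λ f n → ℤ.- f n
  ; 0#      = λ _ → + 0
  ; 1#      = one
  ; isCommutativeRing = record
    { isRing = record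
      { +-isAbelianGroup = record
        { isGroup = record
          { isMonoid = record
            { isSemigroup = record
              { isMagma = record
                { isEquivalence = record
                  { refl  = λ n _ → ≡.refl
                  ; sym   = λ f≈g n n<L → ≡.sym (f≈g n n<L)
                  ; trans = λ f≈g g≈h n n<L → ≡.trans (f≈g n n<L) (g≈h n n<L)
                  }
                ; ∙-cong = λ f≈g h≈k n n<L → ≡.cong₂ ℤ._+_ (f≈g n n<L) (h≈k n n<L)
                }
              ; assoc = λ f g h n _ → ℤₚ.+-assoc (f n) (g n) (h n)
              }
            ; identity = (λ f n _ → ℤₚ.+-identityˡ (f n)) , (λ f n _ → ℤₚ.+-identityʳ (f n))
            }
          ; inverse = (λ f n _ → ℤₚ.+-inverseˡ (f n)) , (λ f n _ → ℤₚ.+-inverseʳ (f n))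
          ; ⁻¹-cong = λ f≈g n n<L → ≡.cong ℤ.-_ (f≈g n n<L)
          }
        ; comm = λ f g n _ → ℤₚ.+-comm (f n) (g n)
        }
      ; *-cong = λ f≈g h≈k n n<L → ⋆-cong n (λ i i≤n → f≈g i (ℕₚ.≤-<-trans i≤n n<L)) (λ i i≤n → h≈k i (ℕₚ.≤-<-trans i≤n n<L))
      ; *-assoc = λ f g h n _ → ⋆-assoc n f g h
      ; *-identity = (λ f n _ → ⋆-identityˡ n f) , (λ f n _ → ≡.trans (⋆-comm n f one) (⋆-identityˡ n f))
      ; distrib = (λ f g h n _ → ≡.trans (⋆-comm n f _) (≡.trans (⋆-distribʳ n g h f) (≡.cong₂ ℤ._+_ (⋆-comm n g f) (⋆-comm n h f))))
                , (λ f g h n _ → ⋆-distribʳ n g h f)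
      }
    ; *-comm = λ f g n _ → ⋆-comm n f g
    }
  }

q : Series
q zero    = + 0
q (suc n) = one n

q⋆-suc : ∀ n f → (q ⋆ f) (suc n) ≡ f n
q⋆-suc n f = ≡.trans (ℤₚ.+-identityˡ _) (⋆-identityˡ n f)

-- Partition generating functions as reciprocals of products

module GeneratingFunctions (L : ℕ) where

  open CommutativeRing (truncatedSeries L) hiding (zero)
  open import Algebra.Properties.CommutativeSemiring.Exp commutativeSemiring
  open import Algebra.Properties.Ring ring using (-‿distribˡ-*)
  open import Algebra.Solver.Ring.NaturalCoefficients.Default commutativeSemiring
    using (_:*_; _:=_) renaming (solve to solveˢ)
  open ThetaFunctions (truncatedSeries L) L

  q^-< : ∀ {s n} → n ℕ.< s → ∀ f → (q ^ s * f) n ≡ + 0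
  q^-< {suc s} {zero}  _           f = ≡.refl
  q^-< {suc s} {suc n} (ℕ.s≤s n<s) f = ≡.trans (⋆-assoc (suc n) q (q ^ s) f) (≡.trans (q⋆-suc n (q ^ s * f)) (q^-< n<s f))

  q^-+ : ∀ s n f → (q ^ s * f) (s ℕ.+ n) ≡ f n
  q^-+ zero    n f = ⋆-identityˡ n f
  q^-+ (suc s) n f = ≡.trans (⋆-assoc (suc (s ℕ.+ n)) q (q ^ s) f) (≡.trans (q⋆-suc (s ℕ.+ n) (q ^ s * f)) (q^-+ s n f))

  nil-q : Nil q
  nil-q n n<L = ≡.trans (≡.sym (*-identityʳ (q ^ L) n n<L)) (q^-< n<L one)

  generating : List ℕ → Series
  generating ks n = + countKinds ks n

  generating-∷ : ∀ {s} ks → 0 ℕ.< s → (1# - q ^ s) * generating (s ∷ ks) ≈ generating ks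
  generating-∷ {s} ks 0<s = begin
    (1# - q ^ s) * G                        ≈⟨ distribʳ G 1# (- (q ^ s)) ⟩
    1# * G + - (q ^ s) * G                  ≈⟨ +-cong (*-identityˡ G) (sym (-‿distribˡ-* (q ^ s) G)) ⟩
    G + - (q ^ s * G)                       ≈⟨ +-congʳ recurrence ⟩
    generating ks + q ^ s * G + - (q ^ s * G)    ≈⟨ +-assoc (generating ks) (q ^ s * G) (- (q ^ s * G)) ⟩
    generating ks + (q ^ s * G + - (q ^ s * G))  ≈⟨ +-congˡ {generating ks} (-‿inverseʳ (q ^ s * G)) ⟩
    generating ks + 0#                      ≈⟨ +-identityʳ (generating ks) ⟩
    generating ks                           ∎
    where
    open import Relation.Binary.Reasoning.Setoid setoid
    G = generating (s ∷ ks)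
    recurrence : G ≈ generating ks + q ^ s * G
    recurrence n _ with s ℕₚ.≤? n
    ... | no  s≰n = ≡.trans (≡.cong (λ k → + k) (countKinds-< s ks (ℕₚ.≰⇒> s≰n)))
      (≡.sym (≡.trans (≡.cong (λ y → generating ks n ℤ.+ y) (q^-< (ℕₚ.≰⇒> s≰n) G)) (ℤₚ.+-identityʳ _)))
    ... | yes s≤n = ≡.subst (λ n → G n ≡ generating ks n ℤ.+ (q ^ s * G) n) (ℕₚ.m+[n∸m]≡n s≤n)
      (≡.trans (≡.cong (λ k → + k) (countKinds-+ s ks 0<s (n ℕ.∸ s)))
               (≡.cong (λ y → generating ks (s ℕ.+ (n ℕ.∸ s)) ℤ.+ y) (≡.sym (q^-+ s (n ℕ.∸ s) G))))

  generating-product : ∀ {ks} → All (0 ℕ.<_) ks → prodOver (λ s → 1# - q ^ s) ks * generating ks ≈ 1#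
  generating-product []           = trans (*-identityˡ (generating [])) (λ { zero _ → ≡.refl ; (suc n) _ → ≡.refl })
  generating-product {s ∷ ks} (0<s ∷ 0<ks) = begin
    (1# - q ^ s) * P * generating (s ∷ ks)    ≈⟨ solveˢ 3 (λ f p g → f :* p :* g := p :* (f :* g)) refl (1# - q ^ s) P (generating (s ∷ ks)) ⟩
    P * ((1# - q ^ s) * generating (s ∷ ks))  ≈⟨ *-congˡ (generating-∷ ks 0<s) ⟩
    P * generating ks                         ≈⟨ generating-product 0<ks ⟩
    1#                                        ∎
    where
    open import Relation.Binary.Reasoning.Setoid setoid
    P = prodOver (λ s → 1# - q ^ s) ks

  open Residues q nil-q

  -- The bound L · 60 is L whole periods, so that every class modulo 60 receives exactly the L
  -- factors of the truncated product `A 60`.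
  generating-periodic : ∀ col → (∀ s → col (60 ℕ.+ s) ≡ col s) →
                        ⟪ kinds col 60 ⟫ * generating (kinds col (L ℕ.* 60)) ≈ 1#
  generating-periodic col periodic = trans
    (*-congʳ (sym (prodOver-kinds col 60 periodic)))
    (generating-product (kinds-positive col (L ℕ.* 60)))

  generating-identity :
    generating (kinds col₇ (L ℕ.* 60)) + q ^ 1 * generating (kinds col₈ (L ℕ.* 60)) ≈
    generating (kinds col₉ (L ℕ.* 60)) + q ^ 2 * generating (kinds col₁₀ (L ℕ.* 60))
  generating-identity = partition-identity
    (generating-periodic col₇ (colors-periodic allowed₇ (10 ∷ []))) (generating-periodic col₈ (colors-periodic allowed₈ (10 ∷ [])))
    (generating-periodic col₉ (colors-periodic allowed₉ (12 ∷ 18 ∷ []))) (generating-periodic col₁₀ (colors-periodic allowed₁₀ (6 ∷ 24 ∷ [])))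

-- Comparison of coefficients

open import Data.Nat using (_+_; _∸_; _<_)

theorem7p3 : (n : ℕ) → 1 < n → p₇ n + p₈ (n ∸ 1) ≡ p₉ n + p₁₀ (n ∸ 2)
theorem7p3 n@(suc (suc m)) (ℕ.s≤s (ℕ.s≤s ℕ.z≤n)) = ℤₚ.+-injective (begin
  + p₇ n ℤ.+ + p₈ (suc m)
    ≡⟨ ≡.cong₂ ℤ._+_ (coefficient col₇ ℕₚ.≤-refl) (≡.trans (coefficient col₈ (ℕₚ.n≤1+n (suc m))) (≡.sym (q^-+ 1 (suc m) (F col₈)))) ⟩
  F col₇ n ℤ.+ (q ^ 1 ⋆ F col₈) n
    ≡⟨ generating-identity n (ℕₚ.n<1+n n) ⟩
  F col₉ n ℤ.+ (q ^ 2 ⋆ F col₁₀) n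
    ≡⟨ ≡.cong₂ ℤ._+_ (coefficient col₉ ℕₚ.≤-refl) (≡.trans (coefficient col₁₀ (ℕₚ.m≤n+m m 2)) (≡.sym (q^-+ 2 m (F col₁₀)))) ⟨
  + p₉ n ℤ.+ + p₁₀ m  ∎)
  where
  -- The smallest truncation in which the coefficient of q^n is still visible.
  L = suc n
  open ≡.≡-Reasoning
  open GeneratingFunctions L
  open import Algebra.Properties.CommutativeSemiring.Exp (CommutativeRing.commutativeSemiring (truncatedSeries L)) using (_^_)
  F : (ℕ → ℕ) → Series
  F col = generating (kinds col (L ℕ.* 60))
  coefficient : ∀ col {k} → k ℕ.≤ n → + colPart col k ≡ F col k
  coefficient col k≤n = ≡.cong (λ k → + k) (≡.sym (colPart-truncate col (ℕₚ.≤-trans k≤n (ℕₚ.≤-trans (ℕₚ.n≤1+n n) (ℕₚ.m≤m*n L 60)))))
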